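{- Let $S$ be the antipode of the Hopf algebra $\mathbf{\Lambda}$ of symmetric functions in superspace and let $\omega:\mathbf{\Lambda}\to\mathbf{\Lambda}$ be the algebra homomorphism with $\omega(p_r)=(-1)^{r-1}p_r$ for $r\ge1$ and $\omega(\tilde p_\ell)=(-1)^\ell\tilde p_\ell$ for $\ell\ge0$. If $f\in\mathbf{\Lambda}$ is homogeneous of total degree $n$ and fermionic degree $m$, then $$S(f)=(-1)^{m+n}\,\omega(f).$$
   Context: Let $x_1,x_2,\dots$ be commuting variables and $\theta_1,\theta_2,\dots$ anticommuting variables ($\theta_i\theta_j=-\theta_j\theta_i$, $\theta_i^2=0$). $\mathbf{\Lambda}$ is the ring of formal power series over $\mathbb Q$ of bounded degree in these variables invariant under simultaneous permutation of the pairs $(x_i,\theta_i)$. Total degree means degree in the $x$'s; fermionic degree means degree in the $\theta$'s. The ring $\mathbf{\Lambda}$ is generated by $p_r=\sum_ix_i^r$ ($r\ge1$) and $\tilde p_k=\sum_i\theta_ix_i^k$ ($k\ge0$), freely up to the (anti)commutation relations. $\mathbf{\Lambda}\otimes\mathbf{\Lambda}$ is identified with functions of two sets of variables $(x;\theta)$, $(y;\phi)$, symmetric in each, with $\theta$'s and $\phi$'s anticommuting with each other; $f\otimes g$ corresponds to $f(x;\theta)g(y;\phi)$, so $(f_1\otimes g_1)(f_2\otimes g_2)=(-1)^{ab}f_1f_2\otimes g_1g_2$ if $g_1,f_2$ have fermionic degrees $a,b$. The coproduct is $(\Delta f)(x,y;\theta,\phi)=f(x,y;\theta,\phi)$, i.e.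 $f$ evaluated on the union of the two sets of variables; the counit $\epsilon$ is the identity on constants and zero on elements homogeneous of positive degree (total plus fermionic). With the multiplication map written $\mathrm{mult}$ and the unit map $u$, the antipode $S$ is the unique linear map with $\mathrm{mult}\circ(S\otimes1)\circ\Delta=u\circ\epsilon=\mathrm{mult}\circ(1\otimes S)\circ\Delta$. It satisfies $S(fg)=(-1)^{ab}S(g)S(f)$ for $f,g$ of fermionic degrees $a,b$. -}

module Defs where

open import Algebra.Bundles.Raw using (RawRing)
open import Algebra.Module.Bundles.Raw using (RawLeftModule)
open import Algebra.Module.Morphism.Structures using (module LeftModuleMorphisms)
open import Algebra.Morphism.Structures using (module RingMorphisms)
open import Data.Bool.Base using (Bool; true; false; if_then_else_)
open import Data.Bool.Properties using () renaming (_≟_ to _≟ᵇ_)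
open import Data.Empty using (⊥-elim)
open import Data.List.Base using (List; []; _∷_; _++_; [_]; map; foldr; upTo; cartesianProductWith)
open import Data.List.Relation.Binary.Permutation.Propositional using (_↭_; refl; prep; swap; trans)
open import Data.List.Relation.Unary.All as All using (All; []; _∷_)
open import Data.List.Relation.Unary.All.Properties using (map⁺; applyUpTo⁺₁) renaming (++⁺ to All-++⁺)
open import Data.Nat.Base as ℕ using (ℕ; zero; suc; NonZero)
import Data.Nat.Properties as ℕ
open import Data.Nat.Tactic.RingSolver using (solve-∀)
open import Data.Product.Base using (_×_; _,_; proj₁; proj₂; ∃-syntax)
open import Data.Product.Properties using (≡-dec)
open import Data.Rational.Base using (ℚ; 0ℚ; 1ℚ; _+_; _*_; -_; +-*-rawSemiring)
open import Data.Rational.Properties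
open import Data.Rational.Solver using (module +-*-Solver)
open import Data.Sum.Base using (_⊎_; inj₁; inj₂)
open import Function.Base using (id; _∘_)
open import Level using (0ℓ)
open import Relation.Binary.Definitions using (DecidableEquality)
open import Relation.Binary.PropositionalEquality as ≡
  using (_≡_; _≢_; _≗_; refl; cong; cong₂; sym; module ≡-Reasoning)
open import Relation.Nullary.Decidable using (does; yes; no)

open import Algebra.Definitions.RawSemiring +-*-rawSemiring using (_^_)

------------------------------------------------------------------------
-- Signs and finite sums

infix 9 -1^_

-1^_ : ℕ → ℚ
-1^ n = (- 1ℚ) ^ n

∑ : {A : Set} → List A → (A → ℚ) → ℚ
∑ xs f = foldr (λ x s → f x + s) 0ℚ xs

------------------------------------------------------------------------
-- Monomials

-- The part of a monomial involving one pair of variables (x , θ):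
-- (a , false) is x^a and (a , true) is x^a θ.
Power : Set
Power = ℕ × Bool

_≟ₚ_ : DecidableEquality Power
_≟ₚ_ = ≡-dec ℕ._≟_ _≟ᵇ_

x^0 : Power
x^0 = 0 , false

δ : Power → Power → ℚ
δ a b = if does (a ≟ₚ b) then 1ℚ else 0ℚ

bit : Bool → ℕ
bit false = 0
bit true  = 1

∣_∣ₓ ∣_∣θ : Power → ℕ
∣ a , _ ∣ₓ = a
∣ _ , e ∣θ = bit e

-- a₁ ∷ … ∷ a_N ∷ [] stands for the product a₁ a₂ ⋯ a_N, in this order, where
-- aᵢ is in the i-th pair of variables.  As (commuting) x's may be moved
-- freely, every monomial is ± one of these; it is written in many ways, which
-- differ by trailing factors x^0.
Monomial : Set
Monomial = List Power

xdeg θdeg : Monomial → ℕ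
xdeg = foldr (λ a n → ∣ a ∣ₓ ℕ.+ n) 0
θdeg = foldr (λ a n → ∣ a ∣θ ℕ.+ n) 0

-- All (b , c) with b c = ± a.
split : Power → List (Power × Power)
split (n , e) = cartesianProductWith (λ (i , j) (ε , η) → (i , ε) , (j , η)) (splitₓ n) (splitθ e)
  where
  splitₓ : ℕ → List (ℕ × ℕ)
  splitₓ n = map (λ i → i , n ℕ.∸ i) (upTo (suc n))

  splitθ : Bool → List (Bool × Bool)
  splitθ false = (false , false) ∷ []
  splitθ true  = (true , false) ∷ (false , true) ∷ []

-- All (β , γ) with β γ = ± α.
splits : Monomial → List (Monomial × Monomial)
splits []      = ([] , []) ∷ []
splits (a ∷ α) = cartesianProductWith (λ (b , c) (β , γ) → b ∷ β , c ∷ γ) (split a) (splits α)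

-- The number of transpositions of θ's needed to bring the product
-- (b₁ b₂ ⋯)(c₁ c₂ ⋯) to the form (b₁ c₁)(b₂ c₂) ⋯.
crossings : Monomial → Monomial → ℕ
crossings (b ∷ β) (c ∷ γ) = ∣ c ∣θ ℕ.* θdeg β ℕ.+ crossings β γ
crossings _       _       = 0

-- A permutation of the pairs (xᵢ , θᵢ) turns the monomial α into a product of
-- the same factors in another order β; this is the sign that arises from
-- reordering the θ's.
sign : {α β : Monomial} → α ↭ β → ℚ
sign refl         = 1ℚ
sign (prep _ π)   = sign π
sign (swap a b π) = -1^ (∣ a ∣θ ℕ.* ∣ b ∣θ) * sign π
sign (trans π ρ)  = sign π * sign ρ

------------------------------------------------------------------------
-- Formal power series in the x's and θ's

-- f α is the coefficient of α.  This defines a power series when f is Stable.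
Coefficients : Set
Coefficients = Monomial → ℚ

Stable : Coefficients → Set
Stable f = ∀ α → f (α ++ [ x^0 ]) ≡ f α

Bounded : Coefficients → Set
Bounded f = ∃[ d ] ∀ α → d ℕ.< xdeg α ℕ.+ θdeg α → f α ≡ 0ℚ

Symmetric : Coefficients → Set
Symmetric f = ∀ {α β} (π : α ↭ β) → f α ≡ sign π * f β

infixl 7 _⊛_

_⊛_ : Coefficients → Coefficients → Coefficients
(f ⊛ g) α = ∑ (splits α) λ (β , γ) → -1^ (crossings β γ) * (f β * g γ)

one : Coefficients
one []      = 1ℚ
one (a ∷ α) = δ a x^0 * one α

-- The sum over i of ℓ in the i-th pair of variables: the summand i = 1, plus
-- the sum over i > 1.  (Not a power series if ℓ = x^0.)
powerSum : Power → Coefficients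
powerSum ℓ []      = 0ℚ
powerSum ℓ (a ∷ α) = δ a ℓ * one α + δ a x^0 * powerSum ℓ α

------------------------------------------------------------------------
-- Stable, symmetric and bounded coefficients are closed under the operations

open ≡-Reasoning

-1^-+ : ∀ m n → -1^ (m ℕ.+ n) ≡ -1^ m * -1^ n
-1^-+ zero    n = sym (*-identityˡ _)
-1^-+ (suc m) n = ≡.trans (cong (- 1ℚ *_) (-1^-+ m n)) (sym (*-assoc (- 1ℚ) (-1^ m) (-1^ n)))

-1^-even : ∀ n → -1^ (n ℕ.+ n) ≡ 1ℚ
-1^-even zero    = refl
-1^-even (suc n) = begin
  -1^ (suc n ℕ.+ suc n)            ≡⟨ cong (λ k → -1^ (suc k)) (ℕ.+-suc n n) ⟩
  - 1ℚ * (- 1ℚ * -1^ (n ℕ.+ n))    ≡⟨ sym (*-assoc (- 1ℚ) (- 1ℚ) (-1^ (n ℕ.+ n))) ⟩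
  1ℚ * -1^ (n ℕ.+ n)               ≡⟨ *-identityˡ _ ⟩
  -1^ (n ℕ.+ n)                    ≡⟨ -1^-even n ⟩
  1ℚ                               ∎

module _ {A : Set} where

  ∑-cong : (xs : List A) {f g : A → ℚ} → All (λ x → f x ≡ g x) xs → ∑ xs f ≡ ∑ xs g
  ∑-cong _        []       = refl
  ∑-cong (x ∷ xs) (p ∷ ps) = cong₂ _+_ p (∑-cong xs ps)

  ∑-ext : (xs : List A) {f g : A → ℚ} → f ≗ g → ∑ xs f ≡ ∑ xs g
  ∑-ext xs p = ∑-cong xs (All.universal p xs)

  ∑-zero : (xs : List A) {f : A → ℚ} → All (λ x → f x ≡ 0ℚ) xs → ∑ xs f ≡ 0ℚ
  ∑-zero _        []       = refl
  ∑-zero (x ∷ xs) (p ∷ ps) = cong₂ _+_ p (∑-zero xs ps)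

  ∑-* : ∀ k (xs : List A) (f : A → ℚ) → ∑ xs (λ x → k * f x) ≡ k * ∑ xs f
  ∑-* k []       f = sym (*-zeroʳ k)
  ∑-* k (x ∷ xs) f = ≡.trans (cong (k * f x +_) (∑-* k xs f)) (sym (*-distribˡ-+ k (f x) (∑ xs f)))

  ∑-+ : (xs : List A) (f g : A → ℚ) → ∑ xs (λ x → f x + g x) ≡ ∑ xs f + ∑ xs g
  ∑-+ []       f g = refl
  ∑-+ (x ∷ xs) f g = ≡.trans (cong (f x + g x +_) (∑-+ xs f g))
    (solve 4 (λ a b c d → (a :+ b) :+ (c :+ d) := (a :+ c) :+ (b :+ d)) refl
      (f x) (g x) (∑ xs f) (∑ xs g))
    where open +-*-Solver

  ∑-++ : (xs ys : List A) (f : A → ℚ) → ∑ (xs ++ ys) f ≡ ∑ xs f + ∑ ys f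
  ∑-++ []       ys f = sym (+-identityˡ _)
  ∑-++ (x ∷ xs) ys f = ≡.trans (cong (f x +_) (∑-++ xs ys f)) (sym (+-assoc (f x) (∑ xs f) (∑ ys f)))

∑-map : {A B : Set} (h : A → B) (xs : List A) (f : B → ℚ) → ∑ (map h xs) f ≡ ∑ xs (f ∘ h)
∑-map h []       f = refl
∑-map h (x ∷ xs) f = cong (f (h x) +_) (∑-map h xs f)

∑-swap : {A B : Set} (xs : List A) (ys : List B) (f : A → B → ℚ) →
         ∑ xs (λ x → ∑ ys (f x)) ≡ ∑ ys (λ y → ∑ xs (λ x → f x y))
∑-swap []       ys f = sym (∑-zero ys (All.universal (λ _ → refl) ys))
∑-swap (x ∷ xs) ys f = ≡.trans (cong (∑ ys (f x) +_) (∑-swap xs ys f))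
  (sym (∑-+ ys (f x) (λ y → ∑ xs (λ x → f x y))))

∑-product : {A B C : Set} (h : A → B → C) (xs : List A) (ys : List B) (f : C → ℚ) →
            ∑ (cartesianProductWith h xs ys) f ≡ ∑ xs (λ x → ∑ ys (λ y → f (h x y)))
∑-product h []       ys f = refl
∑-product h (x ∷ xs) ys f = ≡.trans (∑-++ (map (h x) ys) (cartesianProductWith h xs ys) f)
  (cong₂ _+_ (∑-map (h x) ys f) (∑-product h xs ys f))

All-product : {A B C : Set} {P : A → Set} {Q : B → Set} {R : C → Set}
              (h : A → B → C) → (∀ {x y} → P x → Q y → R (h x y)) →
              ∀ {xs ys} → All P xs → All Q ys → All R (cartesianProductWith h xs ys)
All-product h k []       qs = []
All-product h k (p ∷ ps) qs = All-++⁺ (map⁺ (All.map (k p) qs)) (All-product h k ps qs)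

split-degrees : ∀ a → All (λ (b , c) → ∣ b ∣ₓ ℕ.+ ∣ c ∣ₓ ≡ ∣ a ∣ₓ × ∣ b ∣θ ℕ.+ ∣ c ∣θ ≡ ∣ a ∣θ) (split a)
split-degrees (n , false) = All-product _ _,_
  (map⁺ (applyUpTo⁺₁ id (suc n) λ i<1+n → ℕ.m+[n∸m]≡n (ℕ.≤-pred i<1+n)))
  (refl ∷ [])
split-degrees (n , true)  = All-product _ _,_
  (map⁺ (applyUpTo⁺₁ id (suc n) λ i<1+n → ℕ.m+[n∸m]≡n (ℕ.≤-pred i<1+n)))
  (refl ∷ refl ∷ [])

splits-degrees : ∀ α → All (λ (β , γ) → xdeg β ℕ.+ xdeg γ ≡ xdeg α × θdeg β ℕ.+ θdeg γ ≡ θdeg α) (splits α)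
splits-degrees []      = (refl , refl) ∷ []
splits-degrees (a ∷ α) = All-product _
  (λ {(b , c)} {(β , γ)} (p , q) (r , s) →
    add ∣ b ∣ₓ ∣ c ∣ₓ (xdeg β) (xdeg γ) p r , add ∣ b ∣θ ∣ c ∣θ (θdeg β) (θdeg γ) q s)
  (split-degrees a) (splits-degrees α)
  where
  interchange : ∀ b c β γ → (b ℕ.+ β) ℕ.+ (c ℕ.+ γ) ≡ (b ℕ.+ c) ℕ.+ (β ℕ.+ γ)
  interchange = solve-∀

  add : ∀ b c β γ {a α} → b ℕ.+ c ≡ a → β ℕ.+ γ ≡ α → (b ℕ.+ β) ℕ.+ (c ℕ.+ γ) ≡ a ℕ.+ α
  add b c β γ p q = ≡.trans (interchange b c β γ) (cong₂ ℕ._+_ p q)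

-- Expansion of a product along the first pair of variables.

after : Power → Coefficients → Coefficients
after b f β = f (b ∷ β)

twist : Power → Coefficients → Coefficients
twist c f β = -1^ (∣ c ∣θ ℕ.* θdeg β) * f β

⊛-∷ : ∀ f g a α → (f ⊛ g) (a ∷ α) ≡ ∑ (split a) (λ (b , c) → (twist c (after b f) ⊛ after c g) α)
⊛-∷ f g a α = ≡.trans (∑-product _ (split a) (splits α) λ (β , γ) → -1^ (crossings β γ) * (f β * g γ))
  (∑-ext (split a) λ (b , c) → ∑-ext (splits α) λ (β , γ) → begin
    -1^ (∣ c ∣θ ℕ.* θdeg β ℕ.+ crossings β γ) * (f (b ∷ β) * g (c ∷ γ))
      ≡⟨ cong (_* (f (b ∷ β) * g (c ∷ γ))) (-1^-+ (∣ c ∣θ ℕ.* θdeg β) (crossings β γ)) ⟩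
    -1^ (∣ c ∣θ ℕ.* θdeg β) * -1^ (crossings β γ) * (f (b ∷ β) * g (c ∷ γ))
      ≡⟨ rearrange (-1^ (∣ c ∣θ ℕ.* θdeg β)) (-1^ (crossings β γ)) (f (b ∷ β)) (g (c ∷ γ)) ⟩
    -1^ (crossings β γ) * (twist c (after b f) β * after c g γ) ∎)
  where
  open +-*-Solver
  rearrange : ∀ p q r s → p * q * (r * s) ≡ q * (p * r * s)
  rearrange = solve 4 (λ p q r s → p :* q :* (r :* s) := q :* (p :* r :* s)) refl

⊛-scale : ∀ {f f′ g g′ k l} → (∀ β → f β ≡ k * f′ β) → (∀ γ → g γ ≡ l * g′ γ) →
          ∀ α → (f ⊛ g) α ≡ k * l * (f′ ⊛ g′) α
⊛-scale {f} {f′} {g} {g′} {k} {l} p q α = ≡.trans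
  (∑-ext (splits α) λ (β , γ) → ≡.trans
    (cong (-1^ (crossings β γ) *_) (cong₂ _*_ (p β) (q γ)))
    (rearrange (-1^ (crossings β γ)) k (f′ β) l (g′ γ)))
  (∑-* (k * l) (splits α) _)
  where
  open +-*-Solver
  rearrange : ∀ s k x l y → s * (k * x * (l * y)) ≡ k * l * (s * (x * y))
  rearrange = solve 5 (λ s k x l y → s :* (k :* x :* (l :* y)) := k :* l :* (s :* (x :* y))) refl

θdeg-↭ : ∀ {α β} → α ↭ β → θdeg α ≡ θdeg β
θdeg-↭ refl         = refl
θdeg-↭ (prep a π)   = cong (∣ a ∣θ ℕ.+_) (θdeg-↭ π)
θdeg-↭ (swap {xs = α} {ys = β} a b π) = ≡.trans
  (cong (λ n → ∣ a ∣θ ℕ.+ (∣ b ∣θ ℕ.+ n)) (θdeg-↭ π)) (exchange ∣ a ∣θ ∣ b ∣θ (θdeg β))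
  where
  exchange : ∀ a b n → a ℕ.+ (b ℕ.+ n) ≡ b ℕ.+ (a ℕ.+ n)
  exchange = solve-∀
θdeg-↭ (trans π ρ)  = ≡.trans (θdeg-↭ π) (θdeg-↭ ρ)

after-symmetric : ∀ {f} b → Symmetric f → Symmetric (after b f)
after-symmetric b f-sym π = f-sym (prep b π)

*-exchange : ∀ p q r → p * (q * r) ≡ q * (p * r)
*-exchange = solve 3 (λ p q r → p :* (q :* r) := q :* (p :* r)) refl
  where open +-*-Solver

twist-symmetric : ∀ {f} c → Symmetric f → Symmetric (twist c f)
twist-symmetric {f} c f-sym {α} {β} π = ≡.trans
  (cong₂ _*_ (cong (λ n → -1^ (∣ c ∣θ ℕ.* n)) (θdeg-↭ π)) (f-sym π))
  (*-exchange (-1^ (∣ c ∣θ ℕ.* θdeg β)) (sign π) (f β))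

⊛-swap : ∀ {f g} → Symmetric f → Symmetric g → ∀ a b α →
         (f ⊛ g) (a ∷ b ∷ α) ≡ -1^ (∣ a ∣θ ℕ.* ∣ b ∣θ) * (f ⊛ g) (b ∷ a ∷ α)
⊛-swap {f} {g} f-sym g-sym a b α = begin
  (f ⊛ g) (a ∷ b ∷ α)
    ≡⟨ expand a b ⟩
  ∑ (split a) (λ s → ∑ (split b) (λ t → term s t))
    ≡⟨ ∑-cong (split a) (All.map (λ {s} p → ∑-cong (split b) (All.map (λ {t} q →
         compare s t (proj₂ p) (proj₂ q)) (split-degrees b))) (split-degrees a)) ⟩
  ∑ (split a) (λ s → ∑ (split b) (λ t → ε * term t s))
    ≡⟨ ∑-swap (split a) (split b) (λ s t → ε * term t s) ⟩
  ∑ (split b) (λ t → ∑ (split a) (λ s → ε * term t s))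
    ≡⟨ ∑-ext (split b) (λ t → ∑-* ε (split a) (term t)) ⟩
  ∑ (split b) (λ t → ε * ∑ (split a) (term t))
    ≡⟨ ∑-* ε (split b) _ ⟩
  ε * ∑ (split b) (λ t → ∑ (split a) (term t))
    ≡⟨ cong (ε *_) (sym (expand b a)) ⟩
  ε * (f ⊛ g) (b ∷ a ∷ α) ∎
  where
  ε = -1^ (∣ a ∣θ ℕ.* ∣ b ∣θ)

  term : Power × Power → Power × Power → ℚ
  term (p , q) (r , s) = (twist s (after r (twist q (after p f))) ⊛ after s (after q g)) α

  expand : ∀ a b → (f ⊛ g) (a ∷ b ∷ α) ≡ ∑ (split a) (λ s → ∑ (split b) (term s))
  expand a b = ≡.trans (⊛-∷ f g a (b ∷ α))
    (∑-ext (split a) λ (p , q) → ⊛-∷ (twist q (after p f)) (after q g) b α)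

  swap-one : ∀ {h} → Symmetric h → ∀ p r β → h (p ∷ r ∷ β) ≡ -1^ (∣ p ∣θ ℕ.* ∣ r ∣θ) * h (r ∷ p ∷ β)
  swap-one {h} h-sym p r β = ≡.trans (h-sym (swap p r refl))
    (cong (_* h (r ∷ p ∷ β)) (*-identityʳ (-1^ (∣ p ∣θ ℕ.* ∣ r ∣θ))))

  gather : ∀ k l m x → -1^ k * (-1^ l * (-1^ m * x)) ≡ -1^ (k ℕ.+ (l ℕ.+ m)) * x
  gather k l m x = begin
    -1^ k * (-1^ l * (-1^ m * x))   ≡⟨ cong (-1^ k *_) (sym (*-assoc (-1^ l) (-1^ m) x)) ⟩
    -1^ k * (-1^ l * -1^ m * x)     ≡⟨ cong (λ y → -1^ k * (y * x)) (sym (-1^-+ l m)) ⟩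
    -1^ k * (-1^ (l ℕ.+ m) * x)     ≡⟨ sym (*-assoc (-1^ k) (-1^ (l ℕ.+ m)) x) ⟩
    -1^ k * -1^ (l ℕ.+ m) * x       ≡⟨ cong (_* x) (sym (-1^-+ k (l ℕ.+ m))) ⟩
    -1^ (k ℕ.+ (l ℕ.+ m)) * x       ∎

  drop-even : ∀ k n → -1^ (k ℕ.+ (n ℕ.+ n)) ≡ -1^ k
  drop-even k n = ≡.trans (-1^-+ k (n ℕ.+ n))
    (≡.trans (cong (-1^ k *_) (-1^-even n)) (*-identityʳ (-1^ k)))

  parity-f : ∀ p q r s n → (q ℕ.* r ℕ.+ s ℕ.* p ℕ.+ p ℕ.* r) ℕ.+ (q ℕ.* n ℕ.+ s ℕ.* (p ℕ.+ n))
           ≡ s ℕ.* n ℕ.+ (q ℕ.* (r ℕ.+ n) ℕ.+ p ℕ.* r) ℕ.+ (s ℕ.* p ℕ.+ s ℕ.* p)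
  parity-f = solve-∀

  parity : ∀ p q r s → (q ℕ.* r ℕ.+ s ℕ.* p ℕ.+ p ℕ.* r) ℕ.+ q ℕ.* s ≡ (p ℕ.+ q) ℕ.* (r ℕ.+ s)
  parity = solve-∀

  swap-f : ∀ p q r s β →
    twist s (after r (twist q (after p f))) β ≡
    -1^ (∣ q ∣θ ℕ.* ∣ r ∣θ ℕ.+ ∣ s ∣θ ℕ.* ∣ p ∣θ ℕ.+ ∣ p ∣θ ℕ.* ∣ r ∣θ) *
      twist q (after p (twist s (after r f))) β
  swap-f p q r s β = begin
    -1^ k₁ * (-1^ k₂ * f (p ∷ r ∷ β))
      ≡⟨ cong (λ y → -1^ k₁ * (-1^ k₂ * y)) (swap-one f-sym p r β) ⟩
    -1^ k₁ * (-1^ k₂ * (-1^ k₃ * y))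
      ≡⟨ gather k₁ k₂ k₃ y ⟩
    -1^ (k₁ ℕ.+ (k₂ ℕ.+ k₃)) * y
      ≡⟨ cong (_* y) (sym (drop-even (k₁ ℕ.+ (k₂ ℕ.+ k₃)) (∣ s ∣θ ℕ.* ∣ p ∣θ))) ⟩
    -1^ (k₁ ℕ.+ (k₂ ℕ.+ k₃) ℕ.+ (∣ s ∣θ ℕ.* ∣ p ∣θ ℕ.+ ∣ s ∣θ ℕ.* ∣ p ∣θ)) * y
      ≡⟨ cong (λ k → -1^ k * y) (sym (parity-f ∣ p ∣θ ∣ q ∣θ ∣ r ∣θ ∣ s ∣θ (θdeg β))) ⟩
    -1^ (k₄ ℕ.+ (k₅ ℕ.+ k₆)) * y
      ≡⟨ sym (gather k₄ k₅ k₆ y) ⟩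
    -1^ k₄ * (-1^ k₅ * (-1^ k₆ * y)) ∎
    where
    y  = f (r ∷ p ∷ β)
    k₁ = ∣ s ∣θ ℕ.* θdeg β
    k₂ = ∣ q ∣θ ℕ.* (∣ r ∣θ ℕ.+ θdeg β)
    k₃ = ∣ p ∣θ ℕ.* ∣ r ∣θ
    k₄ = ∣ q ∣θ ℕ.* ∣ r ∣θ ℕ.+ ∣ s ∣θ ℕ.* ∣ p ∣θ ℕ.+ ∣ p ∣θ ℕ.* ∣ r ∣θ
    k₅ = ∣ q ∣θ ℕ.* θdeg β
    k₆ = ∣ s ∣θ ℕ.* (∣ p ∣θ ℕ.+ θdeg β)

  compare : ∀ s t → ∣ proj₁ s ∣θ ℕ.+ ∣ proj₂ s ∣θ ≡ ∣ a ∣θ → ∣ proj₁ t ∣θ ℕ.+ ∣ proj₂ t ∣θ ≡ ∣ b ∣θ →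
            term s t ≡ ε * term t s
  compare (p , q) (r , s) e e′ = ≡.trans
    (⊛-scale {k = -1^ k} {l = -1^ l} (swap-f p q r s) (swap-one g-sym q s) α)
    (cong (_* term (r , s) (p , q)) (begin
      -1^ k * -1^ l   ≡⟨ sym (-1^-+ k l) ⟩
      -1^ (k ℕ.+ l)   ≡⟨ cong -1^_ (parity ∣ p ∣θ ∣ q ∣θ ∣ r ∣θ ∣ s ∣θ) ⟩
      -1^ ((∣ p ∣θ ℕ.+ ∣ q ∣θ) ℕ.* (∣ r ∣θ ℕ.+ ∣ s ∣θ)) ≡⟨ cong -1^_ (cong₂ ℕ._*_ e e′) ⟩
      ε               ∎))
    where
    k = ∣ q ∣θ ℕ.* ∣ r ∣θ ℕ.+ ∣ s ∣θ ℕ.* ∣ p ∣θ ℕ.+ ∣ p ∣θ ℕ.* ∣ r ∣θ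
    l = ∣ q ∣θ ℕ.* ∣ s ∣θ

⊛-prep : ∀ {f g} α β k → Symmetric f → Symmetric g →
         (∀ {f g} → Symmetric f → Symmetric g → (f ⊛ g) α ≡ k * (f ⊛ g) β) →
         ∀ a → (f ⊛ g) (a ∷ α) ≡ k * (f ⊛ g) (a ∷ β)
⊛-prep {f} {g} α β k f-sym g-sym ih a = begin
  (f ⊛ g) (a ∷ α)
    ≡⟨ ⊛-∷ f g a α ⟩
  ∑ (split a) (λ (b , c) → (twist c (after b f) ⊛ after c g) α)
    ≡⟨ ∑-ext (split a) (λ (b , c) →
         ih (twist-symmetric c (after-symmetric b f-sym)) (after-symmetric c g-sym)) ⟩
  ∑ (split a) (λ (b , c) → k * (twist c (after b f) ⊛ after c g) β)
    ≡⟨ ∑-* k (split a) _ ⟩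
  k * ∑ (split a) (λ (b , c) → (twist c (after b f) ⊛ after c g) β)
    ≡⟨ cong (k *_) (sym (⊛-∷ f g a β)) ⟩
  k * (f ⊛ g) (a ∷ β) ∎

⊛-symmetric : ∀ {f g} → Symmetric f → Symmetric g → Symmetric (f ⊛ g)
⊛-symmetric f-sym g-sym π = go π f-sym g-sym
  where
  go : ∀ {α β} (π : α ↭ β) {f g} → Symmetric f → Symmetric g → (f ⊛ g) α ≡ sign π * (f ⊛ g) β
  go refl         _     _     = sym (*-identityˡ _)
  go (prep {xs = α} {ys = β} a π) f-sym g-sym = ⊛-prep α β (sign π) f-sym g-sym (go π) a
  go (swap {xs = α} {ys = β} a b π) {f} {g} f-sym g-sym = begin
    (f ⊛ g) (a ∷ b ∷ α)
      ≡⟨ ⊛-prep (b ∷ α) (b ∷ β) (sign π) f-sym g-sym (λ p q → ⊛-prep α β (sign π) p q (go π) b) a ⟩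
    sign π * (f ⊛ g) (a ∷ b ∷ β)
      ≡⟨ cong (sign π *_) (⊛-swap f-sym g-sym a b β) ⟩
    sign π * (ε * (f ⊛ g) (b ∷ a ∷ β))
      ≡⟨ *-exchange (sign π) ε _ ⟩
    ε * (sign π * (f ⊛ g) (b ∷ a ∷ β))
      ≡⟨ sym (*-assoc ε (sign π) ((f ⊛ g) (b ∷ a ∷ β))) ⟩
    ε * sign π * (f ⊛ g) (b ∷ a ∷ β) ∎
    where ε = -1^ (∣ a ∣θ ℕ.* ∣ b ∣θ)
  go (trans {zs = γ} π ρ) {f} {g} f-sym g-sym = ≡.trans (go π f-sym g-sym)
    (≡.trans (cong (sign π *_) (go ρ f-sym g-sym)) (sym (*-assoc (sign π) (sign ρ) ((f ⊛ g) γ))))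

after-stable : ∀ {f} b → Stable f → Stable (after b f)
after-stable b f-st β = f-st (b ∷ β)

θdeg-stable : ∀ α → θdeg (α ++ [ x^0 ]) ≡ θdeg α
θdeg-stable []      = refl
θdeg-stable (a ∷ α) = cong (∣ a ∣θ ℕ.+_) (θdeg-stable α)

twist-stable : ∀ {f} c → Stable f → Stable (twist c f)
twist-stable c f-st β = cong₂ _*_ (cong (λ n → -1^ (∣ c ∣θ ℕ.* n)) (θdeg-stable β)) (f-st β)

⊛-stable : ∀ {f g} → Stable f → Stable g → Stable (f ⊛ g)
⊛-stable f-st g-st []      = cong₂ (λ y z → 1ℚ * (y * z) + 0ℚ) (f-st []) (g-st [])
⊛-stable {f} {g} f-st g-st (a ∷ α) = begin
  (f ⊛ g) (a ∷ α ++ [ x^0 ])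
    ≡⟨ ⊛-∷ f g a (α ++ [ x^0 ]) ⟩
  ∑ (split a) (λ (b , c) → (twist c (after b f) ⊛ after c g) (α ++ [ x^0 ]))
    ≡⟨ ∑-ext (split a) (λ (b , c) →
         ⊛-stable (twist-stable c (after-stable b f-st)) (after-stable c g-st) α) ⟩
  ∑ (split a) (λ (b , c) → (twist c (after b f) ⊛ after c g) α)
    ≡⟨ sym (⊛-∷ f g a α) ⟩
  (f ⊛ g) (a ∷ α) ∎

exceeds : ∀ d e m n → d ℕ.+ e ℕ.< m ℕ.+ n → d ℕ.< m ⊎ e ℕ.< n
exceeds d e m n d+e<m+n with d ℕ.<? m
... | yes d<m = inj₁ d<m
... | no  d≮m = inj₂ (ℕ.+-cancelˡ-< d e n
                  (ℕ.<-≤-trans d+e<m+n (ℕ.+-monoˡ-≤ n (ℕ.≮⇒≥ d≮m))))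

⊛-bounded : ∀ {f g} → Bounded f → Bounded g → Bounded (f ⊛ g)
⊛-bounded {f} {g} (d , f-bd) (e , g-bd) = d ℕ.+ e , λ α d+e<α →
  ∑-zero (splits α) (All.map (λ {s} (p , q) → vanish s
    (≡.subst (d ℕ.+ e ℕ.<_) (regroup α s p q) d+e<α)) (splits-degrees α))
  where
  deg : Monomial → ℕ
  deg β = xdeg β ℕ.+ θdeg β

  interchange : ∀ a b c d → (a ℕ.+ b) ℕ.+ (c ℕ.+ d) ≡ (a ℕ.+ c) ℕ.+ (b ℕ.+ d)
  interchange = solve-∀

  regroup : ∀ α s → xdeg (proj₁ s) ℕ.+ xdeg (proj₂ s) ≡ xdeg α →
            θdeg (proj₁ s) ℕ.+ θdeg (proj₂ s) ≡ θdeg α → deg α ≡ deg (proj₁ s) ℕ.+ deg (proj₂ s)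
  regroup α (β , γ) p q = ≡.trans (cong₂ ℕ._+_ (sym p) (sym q))
    (interchange (xdeg β) (xdeg γ) (θdeg β) (θdeg γ))

  vanish : ∀ s → d ℕ.+ e ℕ.< deg (proj₁ s) ℕ.+ deg (proj₂ s) →
           -1^ (crossings (proj₁ s) (proj₂ s)) * (f (proj₁ s) * g (proj₂ s)) ≡ 0ℚ
  vanish (β , γ) lt with exceeds d e (deg β) (deg γ) lt
  ... | inj₁ d<β = ≡.trans (cong (-1^ (crossings β γ) *_)
                     (≡.trans (cong (_* g γ) (f-bd β d<β)) (*-zeroˡ (g γ)))) (*-zeroʳ (-1^ (crossings β γ)))
  ... | inj₂ e<γ = ≡.trans (cong (-1^ (crossings β γ) *_)
                     (≡.trans (cong (f β *_) (g-bd γ e<γ)) (*-zeroʳ (f β)))) (*-zeroʳ (-1^ (crossings β γ)))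

δ-≢ : ∀ a b → a ≢ b → δ a b ≡ 0ℚ
δ-≢ a b a≢b with a ≟ₚ b
... | yes a≡b = ⊥-elim (a≢b a≡b)
... | no  _   = refl

-- A sign is 1 where one of the two factors exchanged is trivial.
δ-signˡ : ∀ a b y → δ a x^0 * y ≡ -1^ (∣ a ∣θ ℕ.* ∣ b ∣θ) * (δ a x^0 * y)
δ-signˡ a b y with a ≟ₚ x^0
... | yes refl = sym (*-identityˡ _)
... | no  _    = ≡.trans (*-zeroˡ y)
  (sym (≡.trans (cong (-1^ (∣ a ∣θ ℕ.* ∣ b ∣θ) *_) (*-zeroˡ y)) (*-zeroʳ (-1^ (∣ a ∣θ ℕ.* ∣ b ∣θ)))))

δ-signʳ : ∀ a b y → δ b x^0 * y ≡ -1^ (∣ a ∣θ ℕ.* ∣ b ∣θ) * (δ b x^0 * y)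
δ-signʳ a b y = ≡.trans (δ-signˡ b a y)
  (cong (λ k → -1^ k * (δ b x^0 * y)) (ℕ.*-comm ∣ b ∣θ ∣ a ∣θ))

one-prep : ∀ a α β k → one α ≡ k * one β → one (a ∷ α) ≡ k * one (a ∷ β)
one-prep a α β k p = ≡.trans (cong (δ a x^0 *_) p) (*-exchange (δ a x^0) k (one β))

one-symmetric : Symmetric one
one-symmetric refl         = sym (*-identityˡ _)
one-symmetric (prep {xs = α} {ys = β} a π) = one-prep a α β (sign π) (one-symmetric π)
one-symmetric (swap {xs = α} {ys = β} a b π) = begin
  δ a x^0 * (δ b x^0 * one α)
    ≡⟨ one-prep a (b ∷ α) (b ∷ β) (sign π) (one-prep b α β (sign π) (one-symmetric π)) ⟩
  sign π * (δ a x^0 * (δ b x^0 * one β))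
    ≡⟨ cong (sign π *_) (δ-signˡ a b _) ⟩
  sign π * (ε * (δ a x^0 * (δ b x^0 * one β)))
    ≡⟨ rearrange (sign π) ε (δ a x^0) (δ b x^0) (one β) ⟩
  ε * sign π * (δ b x^0 * (δ a x^0 * one β)) ∎
  where
  open +-*-Solver
  ε = -1^ (∣ a ∣θ ℕ.* ∣ b ∣θ)
  rearrange : ∀ s e a b o → s * (e * (a * (b * o))) ≡ e * s * (b * (a * o))
  rearrange = solve 5 (λ s e a b o → s :* (e :* (a :* (b :* o))) := e :* s :* (b :* (a :* o))) refl
one-symmetric (trans {zs = γ} π ρ) = ≡.trans (one-symmetric π)
  (≡.trans (cong (sign π *_) (one-symmetric ρ)) (sym (*-assoc (sign π) (sign ρ) (one γ))))

one-stable : Stable one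
one-stable []      = refl
one-stable (a ∷ α) = cong (δ a x^0 *_) (one-stable α)

deg-∷ : ∀ a α → xdeg (a ∷ α) ℕ.+ θdeg (a ∷ α) ≡ ∣ a ∣ₓ ℕ.+ ∣ a ∣θ ℕ.+ (xdeg α ℕ.+ θdeg α)
deg-∷ a α = interchange ∣ a ∣ₓ (xdeg α) ∣ a ∣θ (θdeg α)
  where
  interchange : ∀ a b c d → (a ℕ.+ b) ℕ.+ (c ℕ.+ d) ≡ (a ℕ.+ c) ℕ.+ (b ℕ.+ d)
  interchange = solve-∀

one-vanishes : ∀ α → 0 ℕ.< xdeg α ℕ.+ θdeg α → one α ≡ 0ℚ
one-vanishes (a ∷ α) lt with a ≟ₚ x^0
... | yes refl = ≡.trans (*-identityˡ _) (one-vanishes α lt)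
... | no  _    = *-zeroˡ (one α)

module _ (ℓ : Power) where

  powerSum-prep : ∀ a {α β} (π : α ↭ β) → powerSum ℓ α ≡ sign π * powerSum ℓ β →
                  powerSum ℓ (a ∷ α) ≡ sign π * powerSum ℓ (a ∷ β)
  powerSum-prep a {α} {β} π p = ≡.trans
    (cong₂ _+_ (cong (δ a ℓ *_) (one-symmetric π)) (cong (δ a x^0 *_) p))
    (rearrange (δ a ℓ) (δ a x^0) (sign π) (one β) (powerSum ℓ β))
    where
    open +-*-Solver
    rearrange : ∀ a b k x y → a * (k * x) + b * (k * y) ≡ k * (a * x + b * y)
    rearrange = solve 5 (λ a b k x y → a :* (k :* x) :+ b :* (k :* y) := k :* (a :* x :+ b :* y)) refl

  powerSum-swap : ∀ a b α → powerSum ℓ (a ∷ b ∷ α) ≡ -1^ (∣ a ∣θ ℕ.* ∣ b ∣θ) * powerSum ℓ (b ∷ a ∷ α)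
  powerSum-swap a b α = begin
    δ a ℓ * (δ b x^0 * o) + δ a x^0 * (δ b ℓ * o + δ b x^0 * s)
      ≡⟨ solve 6 (λ a₁ a₀ b₁ b₀ o s → a₁ :* (b₀ :* o) :+ a₀ :* (b₁ :* o :+ b₀ :* s)
           := b₀ :* (a₁ :* o) :+ a₀ :* (b₁ :* o :+ b₀ :* s)) refl
           (δ a ℓ) (δ a x^0) (δ b ℓ) (δ b x^0) o s ⟩
    δ b x^0 * (δ a ℓ * o) + δ a x^0 * (δ b ℓ * o + δ b x^0 * s)
      ≡⟨ cong₂ _+_ (δ-signʳ a b _) (δ-signˡ a b _) ⟩
    ε * (δ b x^0 * (δ a ℓ * o)) + ε * (δ a x^0 * (δ b ℓ * o + δ b x^0 * s))
      ≡⟨ solve 7 (λ e a₁ a₀ b₁ b₀ o s →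
           e :* (b₀ :* (a₁ :* o)) :+ e :* (a₀ :* (b₁ :* o :+ b₀ :* s))
           := e :* (b₁ :* (a₀ :* o) :+ b₀ :* (a₁ :* o :+ a₀ :* s))) refl
           ε (δ a ℓ) (δ a x^0) (δ b ℓ) (δ b x^0) o s ⟩
    ε * (δ b ℓ * (δ a x^0 * o) + δ b x^0 * (δ a ℓ * o + δ a x^0 * s)) ∎
    where
    open +-*-Solver
    ε = -1^ (∣ a ∣θ ℕ.* ∣ b ∣θ)
    o = one α
    s = powerSum ℓ α

  powerSum-symmetric : Symmetric (powerSum ℓ)
  powerSum-symmetric refl         = sym (*-identityˡ _)
  powerSum-symmetric (prep a π)   = powerSum-prep a π (powerSum-symmetric π)
  powerSum-symmetric (swap {xs = α} {ys = β} a b π) = begin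
    powerSum ℓ (a ∷ b ∷ α)
      ≡⟨ powerSum-prep a (prep b π) (powerSum-prep b π (powerSum-symmetric π)) ⟩
    sign π * powerSum ℓ (a ∷ b ∷ β)
      ≡⟨ cong (sign π *_) (powerSum-swap a b β) ⟩
    sign π * (ε * powerSum ℓ (b ∷ a ∷ β))
      ≡⟨ *-exchange (sign π) ε _ ⟩
    ε * (sign π * powerSum ℓ (b ∷ a ∷ β))
      ≡⟨ sym (*-assoc ε (sign π) (powerSum ℓ (b ∷ a ∷ β))) ⟩
    ε * sign π * powerSum ℓ (b ∷ a ∷ β) ∎
    where ε = -1^ (∣ a ∣θ ℕ.* ∣ b ∣θ)
  powerSum-symmetric (trans {zs = γ} π ρ) = ≡.trans (powerSum-symmetric π)
    (≡.trans (cong (sign π *_) (powerSum-symmetric ρ)) (sym (*-assoc (sign π) (sign ρ) (powerSum ℓ γ))))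

  powerSum-stable : x^0 ≢ ℓ → Stable (powerSum ℓ)
  powerSum-stable ℓ≢x^0 []      = cong (λ y → y * 1ℚ + 0ℚ) (δ-≢ x^0 ℓ ℓ≢x^0)
  powerSum-stable ℓ≢x^0 (a ∷ α) = cong₂ (λ y z → δ a ℓ * y + δ a x^0 * z)
    (one-stable α) (powerSum-stable ℓ≢x^0 α)

  powerSum-vanishes : ∀ α → ∣ ℓ ∣ₓ ℕ.+ ∣ ℓ ∣θ ℕ.< xdeg α ℕ.+ θdeg α → powerSum ℓ α ≡ 0ℚ
  powerSum-vanishes []      lt = refl
  powerSum-vanishes (a ∷ α) lt = cong₂ _+_ first rest
    where
    lt′ : ∣ ℓ ∣ₓ ℕ.+ ∣ ℓ ∣θ ℕ.< ∣ a ∣ₓ ℕ.+ ∣ a ∣θ ℕ.+ (xdeg α ℕ.+ θdeg α)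
    lt′ = ≡.subst (∣ ℓ ∣ₓ ℕ.+ ∣ ℓ ∣θ ℕ.<_) (deg-∷ a α) lt

    first : δ a ℓ * one α ≡ 0ℚ
    first with a ≟ₚ ℓ
    ... | no  _    = *-zeroˡ (one α)
    ... | yes refl = ≡.trans (*-identityˡ _) (one-vanishes α
      (ℕ.+-cancelˡ-< (∣ ℓ ∣ₓ ℕ.+ ∣ ℓ ∣θ) 0 (xdeg α ℕ.+ θdeg α)
        (≡.subst (ℕ._< ∣ ℓ ∣ₓ ℕ.+ ∣ ℓ ∣θ ℕ.+ (xdeg α ℕ.+ θdeg α)) (sym (ℕ.+-identityʳ (∣ ℓ ∣ₓ ℕ.+ ∣ ℓ ∣θ))) lt′)))

    rest : δ a x^0 * powerSum ℓ α ≡ 0ℚ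
    rest with a ≟ₚ x^0
    ... | no  _    = *-zeroˡ (powerSum ℓ α)
    ... | yes refl = ≡.trans (*-identityˡ _) (powerSum-vanishes α lt)

------------------------------------------------------------------------
-- The ring of symmetric functions in superspace

record Λ : Set where
  field
    coeff     : Coefficients
    stable    : Stable coeff
    symmetric : Symmetric coeff
    bounded   : Bounded coeff

open Λ public using (coeff)

infix 4 _≈_

_≈_ : Λ → Λ → Set
f ≈ g = coeff f ≗ coeff g

infixl 6 _⊞_
infixl 7 _⊠_
infixr 7 _•_

_⊞_ : Λ → Λ → Λ
f ⊞ g = record
  { coeff     = λ α → coeff f α + coeff g α
  ; stable    = λ α → cong₂ _+_ (Λ.stable f α) (Λ.stable g α)
  ; symmetric = λ {_} {β} π → ≡.trans (cong₂ _+_ (Λ.symmetric f π) (Λ.symmetric g π))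
                  (sym (*-distribˡ-+ (sign π) (coeff f β) (coeff g β)))
  ; bounded   = proj₁ (Λ.bounded f) ℕ.+ proj₁ (Λ.bounded g) , λ α lt → cong₂ _+_
                  (proj₂ (Λ.bounded f) α (ℕ.≤-<-trans (ℕ.m≤m+n _ _) lt))
                  (proj₂ (Λ.bounded g) α (ℕ.≤-<-trans (ℕ.m≤n+m _ _) lt))
  }

_•_ : ℚ → Λ → Λ
k • f = record
  { coeff     = λ α → k * coeff f α
  ; stable    = λ α → cong (k *_) (Λ.stable f α)
  ; symmetric = λ {_} {β} π → ≡.trans (cong (k *_) (Λ.symmetric f π)) (*-exchange k (sign π) (coeff f β))
  ; bounded   = proj₁ (Λ.bounded f) , λ α lt →
                  ≡.trans (cong (k *_) (proj₂ (Λ.bounded f) α lt)) (*-zeroʳ k)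
  }

⊟_ : Λ → Λ
⊟ f = (- 1ℚ) • f

𝟙 : Λ
𝟙 = record
  { coeff     = one
  ; stable    = one-stable
  ; symmetric = one-symmetric
  ; bounded   = 0 , one-vanishes
  }

𝟘 : Λ
𝟘 = 0ℚ • 𝟙

_⊠_ : Λ → Λ → Λ
f ⊠ g = record
  { coeff     = coeff f ⊛ coeff g
  ; stable    = ⊛-stable (Λ.stable f) (Λ.stable g)
  ; symmetric = ⊛-symmetric (Λ.symmetric f) (Λ.symmetric g)
  ; bounded   = ⊛-bounded (Λ.bounded f) (Λ.bounded g)
  }

p : (r : ℕ) .{{_ : NonZero r}} → Λ
p r@(suc _) = record
  { coeff     = powerSum (r , false)
  ; stable    = powerSum-stable (r , false) λ ()
  ; symmetric = powerSum-symmetric (r , false)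
  ; bounded   = _ , powerSum-vanishes (r , false)
  }

p~ : ℕ → Λ
p~ k = record
  { coeff     = powerSum (k , true)
  ; stable    = powerSum-stable (k , true) λ ()
  ; symmetric = powerSum-symmetric (k , true)
  ; bounded   = _ , powerSum-vanishes (k , true)
  }

Λ-rawRing : RawRing 0ℓ 0ℓ
Λ-rawRing = record
  { Carrier = Λ ; _≈_ = _≈_ ; _+_ = _⊞_ ; _*_ = _⊠_ ; -_ = ⊟_ ; 0# = 𝟘 ; 1# = 𝟙 }

Λ-rawModule : RawLeftModule ℚ 0ℓ 0ℓ
Λ-rawModule = record
  { Carrierᴹ = Λ ; _≈ᴹ_ = _≈_ ; _+ᴹ_ = _⊞_ ; _*ₗ_ = _•_ ; 0ᴹ = 𝟘 ; -ᴹ_ = ⊟_ }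

open LeftModuleMorphisms Λ-rawModule Λ-rawModule public
  using () renaming (IsLeftModuleHomomorphism to IsLinear)
open RingMorphisms Λ-rawRing Λ-rawRing public
  using (IsRingHomomorphism)

record IsAlgebraHomomorphism (φ : Λ → Λ) : Set where
  field
    isRingHomomorphism : IsRingHomomorphism φ
    isLinear           : IsLinear φ

Homogeneous : ℕ → ℕ → Λ → Set
Homogeneous n m f = ∀ α → coeff f α ≢ 0ℚ → xdeg α ≡ n × θdeg α ≡ m

------------------------------------------------------------------------
-- The Hopf structure

-- Functions of (x ; θ) and (y ; φ): F α β is the coefficient of α(x ; θ) β(y ; φ).
Coefficients² : Set
Coefficients² = Monomial → Monomial → ℚ

infix 4 _≈²_

_≈²_ : Coefficients² → Coefficients² → Set
F ≈² G = ∀ α β → F α β ≡ G α β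

-- A finite sum of f ⊗ g's, given by the list of pairs (f , g).  Two sums are
-- the same element of Λ ⊗ Λ when they are equal as functions, i.e. when their
-- ⟦_⟧'s are.
Λ⊗Λ : Set
Λ⊗Λ = List (Λ × Λ)

⟦_⟧ : Λ⊗Λ → Coefficients²
⟦ t ⟧ α β = ∑ t λ (f , g) → coeff f α * coeff g β

-- f on the union of the two sets of variables.  If α and β have lengths N and
-- M, then the coefficient is not changed by setting all variables other than
-- x₁ … x_N, y₁ … y_M (and their partners) to 0, and by symmetry f may then be
-- evaluated on these in this order.
Δ : Λ → Coefficients²
Δ f α β = coeff f (α ++ β)

-- The constant term: identity on constants, zero on elements of positive degree.
ε : Λ → ℚ
ε f = coeff f []

u : ℚ → Λ
u k = k • 𝟙

mult : Λ⊗Λ → Λ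
mult = foldr (λ (f , g) s → f ⊠ g ⊞ s) 𝟘

-- Used only for φ and ψ of fermionic degree 0, where there is no sign.
_⊗_ : (Λ → Λ) → (Λ → Λ) → Λ⊗Λ → Λ⊗Λ
φ ⊗ ψ = map λ (f , g) → φ f , ψ g

-- Δ f is a function of two sets of variables, so the composites with Δ are
-- stated for each t in Λ ⊗ Λ that is equal to it.
record IsAntipode (S : Λ → Λ) : Set where
  field
    isLinear : IsLinear S
    left     : ∀ f t → ⟦ t ⟧ ≈² Δ f → mult ((S ⊗ id) t) ≈ u (ε f)
    right    : ∀ f t → ⟦ t ⟧ ≈² Δ f → mult ((id ⊗ S) t) ≈ u (ε f)

{-# OPTIONS --safe #-}
module Submission where

-- Every f is a polynomial in the power sums: writing ∂ₐ f for the series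
-- α ↦ f(a α), where a is a power of one fresh pair of variables, ∑ₐ pₐ ∂ₐ f
-- agrees with k f on the monomials that involve k or more pairs of variables,
-- if f vanishes on those that involve more than k; as ∂ₐ f involves at most
-- k - 1 pairs, f is reached by induction on k, dividing by k.  On a product of
-- k power sums, each of which is primitive, the axiom of the antipode forces
-- S to be (-1)^k, and ω multiplies each factor of degrees n and m by
-- - (-1)^(m+n).

open import Defs
open import Data.Nat.Base using (ℕ; NonZero; _+_; _∸_)
open import Data.Bool.Base using (Bool; true; false)
open import Data.List.Base using (List; []; _∷_; _++_; [_]; length; map; upTo; applyUpTo)
open import Data.List.Properties using (map-upTo)
open import Data.List.Relation.Binary.Permutation.Propositional as ↭ using (_↭_; swap)
open import Data.List.Relation.Unary.All as All using (All; []; _∷_)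
open import Data.List.Relation.Unary.All.Properties using (map⁺; ++⁺)
open import Data.Nat.Base as ℕ using (zero; suc)
import Data.Nat.Properties as ℕ
open import Data.Nat.Tactic.RingSolver using (solve-∀)
open import Data.Product.Base using (_×_; _,_; proj₁; proj₂; ∃-syntax)
open import Data.Rational.Base as ℚ using (ℚ; 0ℚ; 1ℚ; _*_; -_)
open import Data.Rational.Properties as ℚ using
  (*-assoc; *-identityˡ; *-identityʳ; *-zeroˡ; *-zeroʳ; *-distribˡ-+)
open import Data.Rational.Solver using (module +-*-Solver)
open import Data.Sum.Base using (inj₁; inj₂)
open import Function.Base using (_∘_; flip; id)
open import Relation.Binary.PropositionalEquality as ≡
  using (_≡_; _≢_; _≗_; refl; cong; cong₂; sym; trans; module ≡-Reasoning)
open import Relation.Nullary.Decidable using (yes; no)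
open import Relation.Nullary.Negation using (contradiction)

open ≡-Reasoning
open +-*-Solver using (solve; _:+_; _:*_; _:=_; con)

-- Sums over the factorisations of a power

-- As Λ is given by coefficients, neither the laws of its multiplication nor its generation by the
-- power sums comes for free; both are proved on monomials, by expansion along the first pair of
-- variables. The decomposition into products of power sums does not keep track of homogeneity. The
-- sign (-1)^(m+n) is therefore turned into the automorphism `grade`, which acts monomial by
-- monomial, and `S f ≈ ω (grade f)` is proved for every `f`. Of `S` only linearity and the axiom
-- are given, and the axiom speaks of tensors that represent `Δ f`; so for each product of k
-- generators such a tensor is written down. Its 2^k terms are signed A ⊗ B, each of which
-- multiplies back to the whole product, and the alternating sum of (-1)^|A| over the subsets A of a
-- nonempty set is 0. So the sign (-1)^k solves the axiom, and the axiom determines `S` on a product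
-- from its values on shorter ones.

∑ₓ : ℕ → (ℕ → ℕ → ℚ) → ℚ
∑ₓ zero    F = F 0 0
∑ₓ (suc n) F = F 0 (suc n) ℚ.+ ∑ₓ n (F ∘ suc)

∑θ : Bool → (Bool → Bool → ℚ) → ℚ
∑θ false F = F false false
∑θ true  F = F true false ℚ.+ F false true

∑ₓ-ext : ∀ n {F G : ℕ → ℕ → ℚ} → (∀ i j → F i j ≡ G i j) → ∑ₓ n F ≡ ∑ₓ n G
∑ₓ-ext zero    F≡G = F≡G 0 0
∑ₓ-ext (suc n) F≡G = cong₂ ℚ._+_ (F≡G 0 (suc n)) (∑ₓ-ext n (F≡G ∘ suc))

∑θ-ext : ∀ e {F G : Bool → Bool → ℚ} → (∀ s t → F s t ≡ G s t) → ∑θ e F ≡ ∑θ e G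
∑θ-ext false F≡G = F≡G false false
∑θ-ext true  F≡G = cong₂ ℚ._+_ (F≡G true false) (F≡G false true)

+-interchange : ∀ a b c d → (a ℚ.+ b) ℚ.+ (c ℚ.+ d) ≡ (a ℚ.+ c) ℚ.+ (b ℚ.+ d)
+-interchange = solve 4 (λ a b c d → (a :+ b) :+ (c :+ d) := (a :+ c) :+ (b :+ d)) refl

∑ₓ-+ : ∀ n (F G : ℕ → ℕ → ℚ) → ∑ₓ n (λ i j → F i j ℚ.+ G i j) ≡ ∑ₓ n F ℚ.+ ∑ₓ n G
∑ₓ-+ zero    F G = refl
∑ₓ-+ (suc n) F G = trans (cong (F 0 (suc n) ℚ.+ G 0 (suc n) ℚ.+_) (∑ₓ-+ n (F ∘ suc) (G ∘ suc)))
  (+-interchange (F 0 (suc n)) (G 0 (suc n)) (∑ₓ n (F ∘ suc)) (∑ₓ n (G ∘ suc)))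

∑ₓ-∑θ : ∀ n e (F : ℕ → ℕ → Bool → Bool → ℚ) →
        ∑θ e (λ s t → ∑ₓ n (λ i j → F i j s t)) ≡ ∑ₓ n (λ i j → ∑θ e (F i j))
∑ₓ-∑θ n false F = refl
∑ₓ-∑θ n true  F = sym (∑ₓ-+ n _ _)

-- Both sides run over j + k + l = n. The induction peels off the terms with j = 0, which on the
-- left are spread over all i.
∑ₓ-assoc : ∀ n (F : ℕ → ℕ → ℕ → ℚ) →
           ∑ₓ n (λ i l → ∑ₓ i (λ j k → F j k l)) ≡ ∑ₓ n (λ j i → ∑ₓ i (F j))
∑ₓ-assoc zero    F = refl
∑ₓ-assoc (suc n) F = begin
  F 0 0 (suc n) ℚ.+ ∑ₓ n (λ i l → F 0 (suc i) l ℚ.+ ∑ₓ i (λ j k → F (suc j) k l))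
    ≡⟨ cong (F 0 0 (suc n) ℚ.+_) (∑ₓ-+ n _ _) ⟩
  F 0 0 (suc n) ℚ.+ (∑ₓ n (λ i l → F 0 (suc i) l) ℚ.+ ∑ₓ n (λ i l → ∑ₓ i (λ j k → F (suc j) k l)))
    ≡⟨ sym (ℚ.+-assoc (F 0 0 (suc n)) (∑ₓ n (λ i l → F 0 (suc i) l)) (∑ₓ n (λ i l → ∑ₓ i (λ j k → F (suc j) k l)))) ⟩
  ∑ₓ (suc n) (F 0) ℚ.+ ∑ₓ n (λ i l → ∑ₓ i (λ j k → F (suc j) k l))
    ≡⟨ cong (∑ₓ (suc n) (F 0) ℚ.+_) (∑ₓ-assoc n (F ∘ suc)) ⟩
  ∑ₓ (suc n) (F 0) ℚ.+ ∑ₓ n (λ j i → ∑ₓ i (F (suc j))) ∎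

∑θ-assoc : ∀ e (F : Bool → Bool → Bool → ℚ) →
           ∑θ e (λ r u → ∑θ r (λ s t → F s t u)) ≡ ∑θ e (λ s r → ∑θ r (F s))
∑θ-assoc false F = refl
∑θ-assoc true  F = ℚ.+-assoc (F true false false) (F false true false) (F false false true)

∑ₓ-last : ∀ n (F : ℕ → ℕ → ℚ) → ∑ₓ (suc n) F ≡ ∑ₓ n (λ i → F i ∘ suc) ℚ.+ F (suc n) 0
∑ₓ-last zero    F = refl
∑ₓ-last (suc n) F = trans (cong (F 0 (suc (suc n)) ℚ.+_) (∑ₓ-last n (F ∘ suc)))
  (sym (ℚ.+-assoc (F 0 (suc (suc n))) (∑ₓ n (λ i → F (suc i) ∘ suc)) (F (suc (suc n)) 0)))

∑ₓ-flip : ∀ n (F : ℕ → ℕ → ℚ) → ∑ₓ n F ≡ ∑ₓ n (flip F)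
∑ₓ-flip zero    F = refl
∑ₓ-flip (suc n) F = begin
  F 0 (suc n) ℚ.+ ∑ₓ n (F ∘ suc)          ≡⟨ ℚ.+-comm (F 0 (suc n)) (∑ₓ n (F ∘ suc)) ⟩
  ∑ₓ n (F ∘ suc) ℚ.+ F 0 (suc n)          ≡⟨ cong (ℚ._+ F 0 (suc n)) (∑ₓ-flip n (F ∘ suc)) ⟩
  ∑ₓ n (flip (F ∘ suc)) ℚ.+ F 0 (suc n)   ≡⟨ sym (∑ₓ-last n (flip F)) ⟩
  ∑ₓ (suc n) (flip F)                     ∎

∑θ-flip : ∀ e (F : Bool → Bool → ℚ) → ∑θ e F ≡ ∑θ e (flip F)
∑θ-flip false F = refl
∑θ-flip true  F = ℚ.+-comm (F true false) (F false true)

∑ₓ-head : ∀ n (F : ℕ → ℕ → ℚ) → (∀ i j → F (suc i) j ≡ 0ℚ) → ∑ₓ n F ≡ F 0 n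
∑ₓ-head zero    F _  = refl
∑ₓ-head (suc n) F F0 = trans (cong (F 0 (suc n) ℚ.+_) (zeros n F0)) (ℚ.+-identityʳ (F 0 (suc n)))
  where
  zeros : ∀ n {G : ℕ → ℕ → ℚ} → (∀ i j → G i j ≡ 0ℚ) → ∑ₓ n G ≡ 0ℚ
  zeros zero    G0 = G0 0 0
  zeros (suc n) G0 = cong₂ ℚ._+_ (G0 0 (suc n)) (zeros n (G0 ∘ suc))

∑-upTo : ∀ n (F : ℕ → ℕ → ℚ) → ∑ (upTo (suc n)) (λ i → F i (n ∸ i)) ≡ ∑ₓ n F
∑-upTo zero    F = ℚ.+-identityʳ (F 0 0)
∑-upTo (suc n) F = cong (F 0 (suc n) ℚ.+_) (begin
  ∑ (applyUpTo suc (suc n)) (λ i → F i (suc n ∸ i))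
    ≡⟨ cong (λ xs → ∑ xs (λ i → F i (suc n ∸ i))) (sym (map-upTo suc (suc n))) ⟩
  ∑ (map suc (upTo (suc n))) (λ i → F i (suc n ∸ i))
    ≡⟨ ∑-map suc (upTo (suc n)) (λ i → F i (suc n ∸ i)) ⟩
  ∑ (upTo (suc n)) (λ i → F (suc i) (n ∸ i))
    ≡⟨ ∑-upTo n (F ∘ suc) ⟩
  ∑ₓ n (F ∘ suc) ∎)

-- Trades `upTo` and truncated subtraction for recursion on `n`, and separates x's from θ's, so that
-- identities between sums over `split` reduce to inductions on `n` and cases on `e`.
∑-split : ∀ n e (F : Power → Power → ℚ) →
          ∑ (split (n , e)) (λ (b , c) → F b c) ≡ ∑ₓ n (λ i j → ∑θ e (λ s t → F (i , s) (j , t)))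
∑-split n e F = begin
  ∑ (split (n , e)) F′
    ≡⟨ ∑-split-θ e ⟩
  ∑ (map (λ i → i , n ∸ i) (upTo (suc n))) (λ (i , j) → ∑θ e (λ s t → F (i , s) (j , t)))
    ≡⟨ ∑-map (λ i → i , n ∸ i) (upTo (suc n)) (λ (i , j) → ∑θ e (λ s t → F (i , s) (j , t))) ⟩
  ∑ (upTo (suc n)) (λ i → ∑θ e (λ s t → F (i , s) (n ∸ i , t)))
    ≡⟨ ∑-upTo n (λ i j → ∑θ e (λ s t → F (i , s) (j , t))) ⟩
  ∑ₓ n (λ i j → ∑θ e (λ s t → F (i , s) (j , t))) ∎
  where
  F′ : Power × Power → ℚ
  F′ (b , c) = F b c

  pair : ℕ × ℕ → Bool × Bool → Power × Power
  pair (i , j) (s , t) = (i , s) , (j , t)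

  xs : List (ℕ × ℕ)
  xs = map (λ i → i , n ∸ i) (upTo (suc n))

  ∑-split-θ : ∀ e → ∑ (split (n , e)) F′ ≡ ∑ xs (λ (i , j) → ∑θ e (λ s t → F (i , s) (j , t)))
  ∑-split-θ false = trans (∑-product pair xs ((false , false) ∷ []) F′)
    (∑-ext xs {λ (i , j) → F (i , false) (j , false) ℚ.+ 0ℚ} (λ (i , j) → ℚ.+-identityʳ (F (i , false) (j , false))))
  ∑-split-θ true  = trans (∑-product pair xs ((true , false) ∷ (false , true) ∷ []) F′)
    (∑-ext xs {λ (i , j) → F (i , true) (j , false) ℚ.+ (F (i , false) (j , true) ℚ.+ 0ℚ)}
      (λ (i , j) → cong (F (i , true) (j , false) ℚ.+_) (ℚ.+-identityʳ (F (i , false) (j , true)))))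

∑-split-assoc : ∀ a (F : Power → Power → Power → ℚ) →
  ∑ (split a) (λ (b , c) → ∑ (split b) (λ (d , e) → F d e c)) ≡
  ∑ (split a) (λ (d , b) → ∑ (split b) (λ (e , c) → F d e c))
∑-split-assoc (n , e) F = begin
  ∑ (split (n , e)) (λ (b , c) → ∑ (split b) (λ (d , d′) → F d d′ c))
    ≡⟨ ∑-split n e _ ⟩
  ∑ₓ n (λ i l → ∑θ e (λ r u → ∑ (split (i , r)) (λ (d , d′) → F d d′ (l , u))))
    ≡⟨ ∑ₓ-ext n (λ i l → trans (∑θ-ext e (λ r u → ∑-split i r _)) (∑ₓ-∑θ i e _)) ⟩
  ∑ₓ n (λ i l → ∑ₓ i (λ j k → ∑θ e (λ r u → ∑θ r (λ s t → F (j , s) (k , t) (l , u)))))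
    ≡⟨ ∑ₓ-assoc n _ ⟩
  ∑ₓ n (λ j i → ∑ₓ i (λ k l → ∑θ e (λ r u → ∑θ r (λ s t → F (j , s) (k , t) (l , u)))))
    ≡⟨ ∑ₓ-ext n (λ j i → ∑ₓ-ext i (λ k l → ∑θ-assoc e _)) ⟩
  ∑ₓ n (λ j i → ∑ₓ i (λ k l → ∑θ e (λ s r → ∑θ r (λ t u → F (j , s) (k , t) (l , u)))))
    ≡⟨ ∑ₓ-ext n (λ j i → sym (trans (∑θ-ext e (λ s r → ∑-split i r _)) (∑ₓ-∑θ i e _))) ⟩
  ∑ₓ n (λ j i → ∑θ e (λ s r → ∑ (split (i , r)) (λ (d , c) → F (j , s) d c)))
    ≡⟨ sym (∑-split n e _) ⟩
  ∑ (split (n , e)) (λ (d , b) → ∑ (split b) (λ (d′ , c) → F d d′ c)) ∎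

∑-split-flip : ∀ a (F : Power → Power → ℚ) →
  ∑ (split a) (λ (b , c) → F b c) ≡ ∑ (split a) (λ (b , c) → F c b)
∑-split-flip (n , e) F = begin
  ∑ (split (n , e)) (λ (b , c) → F b c)
    ≡⟨ ∑-split n e F ⟩
  ∑ₓ n (λ i j → ∑θ e (λ s t → F (i , s) (j , t)))
    ≡⟨ ∑ₓ-flip n _ ⟩
  ∑ₓ n (λ i j → ∑θ e (λ s t → F (j , s) (i , t)))
    ≡⟨ ∑ₓ-ext n (λ i j → ∑θ-flip e _) ⟩
  ∑ₓ n (λ i j → ∑θ e (λ s t → F (j , t) (i , s)))
    ≡⟨ sym (∑-split n e (flip F)) ⟩
  ∑ (split (n , e)) (λ (b , c) → F c b) ∎

∑-split-unitˡ : ∀ a (F : Power → Power → ℚ) →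
  ∑ (split a) (λ (b , c) → δ b x^0 * F b c) ≡ F x^0 a
∑-split-unitˡ (n , e) F = begin
  ∑ (split (n , e)) (λ (b , c) → δ b x^0 * F b c)
    ≡⟨ ∑-split n e _ ⟩
  ∑ₓ n (λ i j → ∑θ e (λ s t → δ (i , s) x^0 * F (i , s) (j , t)))
    ≡⟨ ∑ₓ-head n _ (λ i j → zeros i j e) ⟩
  ∑θ e (λ s t → δ (0 , s) x^0 * F (0 , s) (n , t))
    ≡⟨ head e ⟩
  F x^0 (n , e) ∎
  where
  zeros : ∀ i j e → ∑θ e (λ s t → δ (suc i , s) x^0 * F (suc i , s) (j , t)) ≡ 0ℚ
  zeros i j false = *-zeroˡ (F (suc i , false) (j , false))
  zeros i j true  = cong₂ ℚ._+_ (*-zeroˡ (F (suc i , true) (j , false))) (*-zeroˡ (F (suc i , false) (j , true)))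

  head : ∀ e → ∑θ e (λ s t → δ (0 , s) x^0 * F (0 , s) (n , t)) ≡ F x^0 (n , e)
  head false = *-identityˡ (F x^0 (n , false))
  head true  = trans (cong₂ ℚ._+_ (*-zeroˡ (F (0 , true) (n , false))) (*-identityˡ (F x^0 (n , true)))) (ℚ.+-identityˡ (F x^0 (n , true)))

∑-split-unitʳ : ∀ a (F : Power → Power → ℚ) →
  ∑ (split a) (λ (b , c) → δ c x^0 * F b c) ≡ F a x^0
∑-split-unitʳ a F = trans (∑-split-flip a (λ b c → δ c x^0 * F b c)) (∑-split-unitˡ a (flip F))

-- The product of coefficients

⊛-cong : ∀ {f f′ g g′} → f ≗ f′ → g ≗ g′ → f ⊛ g ≗ f′ ⊛ g′
⊛-cong f≗f′ g≗g′ α = ∑-ext (splits α) λ (β , γ) →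
  cong (-1^ (crossings β γ) *_) (cong₂ _*_ (f≗f′ β) (g≗g′ γ))

⊛-scaleʳ : ∀ k f g α → (f ⊛ (λ γ → k * g γ)) α ≡ k * (f ⊛ g) α
⊛-scaleʳ k f g α = trans
  (⊛-scale {f = f} {f′ = f} {g′ = g} {k = 1ℚ} {l = k} (λ β → sym (*-identityˡ (f β))) (λ _ → refl) α)
  (cong (_* (f ⊛ g) α) (*-identityˡ k))

⊛-scaleˡ : ∀ k f g α → ((λ β → k * f β) ⊛ g) α ≡ k * (f ⊛ g) α
⊛-scaleˡ k f g α = trans
  (⊛-scale {f′ = f} {g = g} {g′ = g} {k = k} {l = 1ℚ} (λ _ → refl) (λ γ → sym (*-identityˡ (g γ))) α)
  (cong (_* (f ⊛ g) α) (*-identityʳ k))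

module _ {A : Set} where

  ⊛-∑ˡ : (xs : List A) (F : A → Coefficients) (g : Coefficients) →
         ∀ α → ((λ β → ∑ xs (λ x → F x β)) ⊛ g) α ≡ ∑ xs (λ x → (F x ⊛ g) α)
  ⊛-∑ˡ xs F g α = trans (∑-ext (splits α) λ (β , γ) → begin
    -1^ (crossings β γ) * (∑ xs (λ x → F x β) * g γ)
      ≡⟨ solve 3 (λ s x y → s :* (x :* y) := (s :* y) :* x) refl (-1^ (crossings β γ)) (∑ xs (λ x → F x β)) (g γ) ⟩
    -1^ (crossings β γ) * g γ * ∑ xs (λ x → F x β)
      ≡⟨ sym (∑-* (-1^ (crossings β γ) * g γ) xs (λ x → F x β)) ⟩
    ∑ xs (λ x → -1^ (crossings β γ) * g γ * F x β)
      ≡⟨ ∑-ext xs (λ x → solve 3 (λ s x y → (s :* y) :* x := s :* (x :* y)) refl (-1^ (crossings β γ)) (F x β) (g γ)) ⟩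
    ∑ xs (λ x → -1^ (crossings β γ) * (F x β * g γ)) ∎)
    (∑-swap (splits α) xs (λ (β , γ) x → -1^ (crossings β γ) * (F x β * g γ)))

  ⊛-∑ʳ : (xs : List A) (f : Coefficients) (G : A → Coefficients) →
         ∀ α → (f ⊛ (λ β → ∑ xs (λ x → G x β))) α ≡ ∑ xs (λ x → (f ⊛ G x) α)
  ⊛-∑ʳ xs f G α = trans (∑-ext (splits α) λ (β , γ) → begin
    -1^ (crossings β γ) * (f β * ∑ xs (λ x → G x γ))
      ≡⟨ sym (*-assoc (-1^ (crossings β γ)) (f β) _) ⟩
    -1^ (crossings β γ) * f β * ∑ xs (λ x → G x γ)
      ≡⟨ sym (∑-* (-1^ (crossings β γ) * f β) xs (λ x → G x γ)) ⟩
    ∑ xs (λ x → -1^ (crossings β γ) * f β * G x γ)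
      ≡⟨ ∑-ext xs (λ x → *-assoc (-1^ (crossings β γ)) (f β) (G x γ)) ⟩
    ∑ xs (λ x → -1^ (crossings β γ) * (f β * G x γ)) ∎)
    (∑-swap (splits α) xs (λ (β , γ) x → -1^ (crossings β γ) * (f β * G x γ)))

-- For an additive `w` this respects products. It serves three times: with `θdeg` for parity, with a
-- multiple of `θdeg` for `twist`, and with `degree` for `grade`.
signed : (Monomial → ℕ) → Coefficients → Coefficients
signed w f α = -1^ w α * f α

Additive : (Monomial → ℕ) → Set
Additive w = ∀ α → All (λ (β , γ) → w β + w γ ≡ w α) (splits α)

signed-⊛ : ∀ w → Additive w → ∀ f g → signed w (f ⊛ g) ≗ signed w f ⊛ signed w g
signed-⊛ w w-+ f g α = trans (sym (∑-* (-1^ w α) (splits α) _))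
  (∑-cong (splits α) (All.map (λ {(β , γ)} e → begin
    -1^ w α * (-1^ (crossings β γ) * (f β * g γ))
      ≡⟨ cong (λ n → -1^ n * (-1^ (crossings β γ) * (f β * g γ))) (sym e) ⟩
    -1^ (w β + w γ) * (-1^ (crossings β γ) * (f β * g γ))
      ≡⟨ cong (_* (-1^ (crossings β γ) * (f β * g γ))) (-1^-+ (w β) (w γ)) ⟩
    -1^ w β * -1^ w γ * (-1^ (crossings β γ) * (f β * g γ))
      ≡⟨ solve 5 (λ a b s x y → (a :* b) :* (s :* (x :* y)) := s :* ((a :* x) :* (b :* y))) refl
           (-1^ w β) (-1^ w γ) (-1^ (crossings β γ)) (f β) (g γ) ⟩
    -1^ (crossings β γ) * (signed w f β * signed w g γ) ∎) (w-+ α)))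

twist-⊛ : ∀ c f g → twist c (f ⊛ g) ≗ twist c f ⊛ twist c g
twist-⊛ c = signed-⊛ (λ α → ∣ c ∣θ ℕ.* θdeg α) λ α → All.map
  (λ {(β , γ)} (_ , e) → trans (sym (ℕ.*-distribˡ-+ ∣ c ∣θ (θdeg β) (θdeg γ))) (cong (∣ c ∣θ ℕ.*_) e))
  (splits-degrees α)

-- Induction on the monomial with arbitrary series, because expanding along the first pair of
-- variables replaces them by twisted `after`s.
⊛-assoc : ∀ f g h → (f ⊛ g) ⊛ h ≗ f ⊛ (g ⊛ h)
⊛-assoc f g h []      = solve 3 (λ x y z →
    con 1ℚ :* ((con 1ℚ :* (x :* y) :+ con 0ℚ) :* z) :+ con 0ℚ
    := con 1ℚ :* (x :* (con 1ℚ :* (y :* z) :+ con 0ℚ)) :+ con 0ℚ) refl (f []) (g []) (h [])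
⊛-assoc f g h (a ∷ α) = begin
  ((f ⊛ g) ⊛ h) (a ∷ α)
    ≡⟨ ⊛-∷ (f ⊛ g) h a α ⟩
  ∑ (split a) (λ (b , c) → (twist c (after b (f ⊛ g)) ⊛ after c h) α)
    ≡⟨ ∑-ext (split a) (λ (b , c) → trans
         (⊛-cong (expand b c) (λ _ → refl) α)
         (⊛-∑ˡ (split b) (λ (d , e) → twist c (twist e (after d f)) ⊛ twist c (after e g)) (after c h) α)) ⟩
  ∑ (split a) (λ (b , c) → ∑ (split b) (λ (d , e) →
    ((twist c (twist e (after d f)) ⊛ twist c (after e g)) ⊛ after c h) α))
    ≡⟨ ∑-ext (split a) (λ (b , c) → ∑-ext (split b) (λ (d , e) →
         ⊛-assoc (twist c (twist e (after d f))) (twist c (after e g)) (after c h) α)) ⟩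
  ∑ (split a) (λ (b , c) → ∑ (split b) (λ (d , e) →
    (twist c (twist e (after d f)) ⊛ (twist c (after e g) ⊛ after c h)) α))
    ≡⟨ ∑-split-assoc a (λ d e c → (twist c (twist e (after d f)) ⊛ (twist c (after e g) ⊛ after c h)) α) ⟩
  ∑ (split a) (λ (d , b) → ∑ (split b) (λ (e , c) →
    (twist c (twist e (after d f)) ⊛ (twist c (after e g) ⊛ after c h)) α))
    -- Moving θ's past `c` and then past `e` is moving them past `b`, since the θ-degrees of `e` and
    -- `c` add up to that of `b`.
    ≡⟨ ∑-ext (split a) (λ (d , b) → ∑-cong (split b) (All.map (λ {(e , c)} (_ , q) →
         ⊛-cong {g = twist c (after e g) ⊛ after c h} (twist-twist c e b (after d f) q) (λ _ → refl) α) (split-degrees b))) ⟩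
  ∑ (split a) (λ (d , b) → ∑ (split b) (λ (e , c) →
    (twist b (after d f) ⊛ (twist c (after e g) ⊛ after c h)) α))
    ≡⟨ ∑-ext (split a) (λ (d , b) → trans
         (sym (⊛-∑ʳ (split b) (twist b (after d f)) (λ (e , c) → twist c (after e g) ⊛ after c h) α))
         (⊛-cong {f = twist b (after d f)} (λ _ → refl) (λ β → sym (⊛-∷ g h b β)) α)) ⟩
  ∑ (split a) (λ (d , b) → (twist b (after d f) ⊛ after b (g ⊛ h)) α)
    ≡⟨ sym (⊛-∷ f (g ⊛ h) a α) ⟩
  (f ⊛ (g ⊛ h)) (a ∷ α) ∎
  where
  expand : ∀ b c → twist c (after b (f ⊛ g)) ≗
    λ β → ∑ (split b) (λ (d , e) → (twist c (twist e (after d f)) ⊛ twist c (after e g)) β)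
  expand b c β = begin
    k * (f ⊛ g) (b ∷ β)
      ≡⟨ cong (k *_) (⊛-∷ f g b β) ⟩
    k * ∑ (split b) (λ (d , e) → (twist e (after d f) ⊛ after e g) β)
      ≡⟨ sym (∑-* k (split b) _) ⟩
    ∑ (split b) (λ (d , e) → k * (twist e (after d f) ⊛ after e g) β)
      ≡⟨ ∑-ext (split b) (λ (d , e) → twist-⊛ c (twist e (after d f)) (after e g) β) ⟩
    ∑ (split b) (λ (d , e) → (twist c (twist e (after d f)) ⊛ twist c (after e g)) β) ∎
    where k = -1^ (∣ c ∣θ ℕ.* θdeg β)

  twist-twist : ∀ c e b h → ∣ e ∣θ + ∣ c ∣θ ≡ ∣ b ∣θ → twist c (twist e h) ≗ twist b h
  twist-twist c e b h q β = begin
    -1^ (∣ c ∣θ ℕ.* θdeg β) * (-1^ (∣ e ∣θ ℕ.* θdeg β) * h β)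
      ≡⟨ sym (*-assoc (-1^ (∣ c ∣θ ℕ.* θdeg β)) _ (h β)) ⟩
    -1^ (∣ c ∣θ ℕ.* θdeg β) * -1^ (∣ e ∣θ ℕ.* θdeg β) * h β
      ≡⟨ cong (_* h β) (sym (-1^-+ (∣ c ∣θ ℕ.* θdeg β) _)) ⟩
    -1^ (∣ c ∣θ ℕ.* θdeg β + ∣ e ∣θ ℕ.* θdeg β) * h β
      ≡⟨ cong (λ n → -1^ n * h β) (trans (sum ∣ c ∣θ ∣ e ∣θ (θdeg β)) (cong (ℕ._* θdeg β) q)) ⟩
    -1^ (∣ b ∣θ ℕ.* θdeg β) * h β ∎
    where
    sum : ∀ c e n → c ℕ.* n + e ℕ.* n ≡ (e + c) ℕ.* n
    sum = solve-∀

⊛-linearˡ : ∀ k l f f′ g α →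
  ((λ β → k * f β ℚ.+ l * f′ β) ⊛ g) α ≡ k * (f ⊛ g) α ℚ.+ l * (f′ ⊛ g) α
⊛-linearˡ k l f f′ g α = begin
  ((λ β → k * f β ℚ.+ l * f′ β) ⊛ g) α
    ≡⟨ ∑-ext (splits α) (λ (β , γ) → solve 6 (λ s k x l y z →
         s :* ((k :* x :+ l :* y) :* z) := k :* (s :* (x :* z)) :+ l :* (s :* (y :* z))) refl
         (-1^ (crossings β γ)) k (f β) l (f′ β) (g γ)) ⟩
  ∑ (splits α) (λ s → k * term f s ℚ.+ l * term f′ s)
    ≡⟨ ∑-+ (splits α) (λ s → k * term f s) (λ s → l * term f′ s) ⟩
  ∑ (splits α) (λ s → k * term f s) ℚ.+ ∑ (splits α) (λ s → l * term f′ s)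
    ≡⟨ cong₂ ℚ._+_ (∑-* k (splits α) (term f)) (∑-* l (splits α) (term f′)) ⟩
  k * (f ⊛ g) α ℚ.+ l * (f′ ⊛ g) α ∎
  where
  term : Coefficients → Monomial × Monomial → ℚ
  term f (β , γ) = -1^ (crossings β γ) * (f β * g γ)

-- Signs from additive weights; parity and supercommutativity

weight : (Power → ℕ) → Monomial → ℕ
weight v []      = 0
weight v (a ∷ α) = v a + weight v α

δ-weight : ∀ (v : Power → ℕ) a b → -1^ v a * δ a b ≡ -1^ v b * δ a b
δ-weight v a b with a ≟ₚ b
... | yes refl = refl
... | no  _    = trans (*-zeroʳ (-1^ v a)) (sym (*-zeroʳ (-1^ v b)))

module _ (v : Power → ℕ) (v0 : v x^0 ≡ 0) where

  δ-weight₀ : ∀ a → -1^ v a * δ a x^0 ≡ δ a x^0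
  δ-weight₀ a = trans (δ-weight v a x^0)
    (trans (cong (λ n → -1^ n * δ a x^0) v0) (*-identityˡ (δ a x^0)))

  one-weight : signed (weight v) one ≗ one
  one-weight []      = refl
  one-weight (a ∷ α) = begin
    -1^ (v a + weight v α) * (δ a x^0 * one α)
      ≡⟨ cong (_* (δ a x^0 * one α)) (-1^-+ (v a) (weight v α)) ⟩
    -1^ v a * -1^ weight v α * (δ a x^0 * one α)
      ≡⟨ solve 4 (λ x y d o → (x :* y) :* (d :* o) := (x :* d) :* (y :* o)) refl
           (-1^ v a) (-1^ weight v α) (δ a x^0) (one α) ⟩
    -1^ v a * δ a x^0 * (-1^ weight v α * one α)
      ≡⟨ cong₂ _*_ (δ-weight₀ a) (one-weight α) ⟩
    δ a x^0 * one α ∎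

  -- A monomial in the support of `powerSum ℓ` consists of one entry `ℓ` among entries `x^0`, which
  -- weigh nothing.
  powerSum-weight : ∀ ℓ → signed (weight v) (powerSum ℓ) ≗ λ α → -1^ v ℓ * powerSum ℓ α
  powerSum-weight ℓ []      = trans (*-zeroʳ 1ℚ) (sym (*-zeroʳ (-1^ v ℓ)))
  powerSum-weight ℓ (a ∷ α) = begin
    -1^ (v a + weight v α) * (δ a ℓ * one α ℚ.+ δ a x^0 * powerSum ℓ α)
      ≡⟨ cong (_* (δ a ℓ * one α ℚ.+ δ a x^0 * powerSum ℓ α)) (-1^-+ (v a) (weight v α)) ⟩
    -1^ v a * -1^ weight v α * (δ a ℓ * one α ℚ.+ δ a x^0 * powerSum ℓ α)
      ≡⟨ solve 6 (λ x y d o e p → (x :* y) :* (d :* o :+ e :* p) := (x :* d) :* (y :* o) :+ (x :* e) :* (y :* p)) refl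
           (-1^ v a) (-1^ weight v α) (δ a ℓ) (one α) (δ a x^0) (powerSum ℓ α) ⟩
    -1^ v a * δ a ℓ * (-1^ weight v α * one α) ℚ.+ -1^ v a * δ a x^0 * (-1^ weight v α * powerSum ℓ α)
      ≡⟨ cong₂ ℚ._+_ (cong₂ _*_ (δ-weight v a ℓ) (one-weight α)) (cong₂ _*_ (δ-weight₀ a) (powerSum-weight ℓ α)) ⟩
    -1^ v ℓ * δ a ℓ * one α ℚ.+ δ a x^0 * (-1^ v ℓ * powerSum ℓ α)
      ≡⟨ solve 5 (λ x d o e p → (x :* d) :* o :+ e :* (x :* p) := x :* (d :* o :+ e :* p)) refl
           (-1^ v ℓ) (δ a ℓ) (one α) (δ a x^0) (powerSum ℓ α) ⟩
    -1^ v ℓ * (δ a ℓ * one α ℚ.+ δ a x^0 * powerSum ℓ α) ∎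

θdeg-weight : ∀ α → θdeg α ≡ weight ∣_∣θ α
θdeg-weight []      = refl
θdeg-weight (a ∷ α) = cong (∣ a ∣θ +_) (θdeg-weight α)

-- Over ℚ this says that `f` is supported on monomials of θ-degree congruent to `m` modulo 2. As an
-- equation it rewrites signs that depend on the monomial into constants.
Parity : ℕ → Coefficients → Set
Parity m f = ∀ α → -1^ θdeg α * f α ≡ -1^ m * f α

one-parity : Parity 0 one
one-parity α = trans (cong (λ n → -1^ n * one α) (θdeg-weight α))
  (trans (one-weight ∣_∣θ refl α) (sym (*-identityˡ (one α))))

powerSum-parity : ∀ ℓ → Parity ∣ ℓ ∣θ (powerSum ℓ)
powerSum-parity ℓ α = trans (cong (λ n → -1^ n * powerSum ℓ α) (θdeg-weight α))
  (powerSum-weight ∣_∣θ refl ℓ α)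

⊛-parity : ∀ {m n f g} → Parity m f → Parity n g → Parity (m + n) (f ⊛ g)
⊛-parity {m} {n} {f} {g} f-par g-par α = begin
  -1^ θdeg α * (f ⊛ g) α
    ≡⟨ signed-⊛ θdeg (λ α → All.map proj₂ (splits-degrees α)) f g α ⟩
  (signed θdeg f ⊛ signed θdeg g) α
    ≡⟨ ⊛-scale {f′ = f} {g′ = g} {k = -1^ m} {l = -1^ n} f-par g-par α ⟩
  -1^ m * -1^ n * (f ⊛ g) α
    ≡⟨ cong (_* (f ⊛ g) α) (sym (-1^-+ m n)) ⟩
  -1^ (m + n) * (f ⊛ g) α ∎

twist-parity : ∀ {m f} c → Parity m f → ∀ α → twist c f α ≡ -1^ (∣ c ∣θ ℕ.* m) * f α
twist-parity     (_ , false) f-par α = refl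
twist-parity {m} {f} (_ , true)  f-par α = begin
  -1^ (θdeg α + 0) * f α   ≡⟨ cong (λ n → -1^ n * f α) (ℕ.+-identityʳ (θdeg α)) ⟩
  -1^ θdeg α * f α         ≡⟨ f-par α ⟩
  -1^ m * f α              ≡⟨ cong (λ n → -1^ n * f α) (sym (ℕ.+-identityʳ m)) ⟩
  -1^ (m + 0) * f α        ∎

-- The θ-degree left over is m minus that of `b`; modulo 2 the sum serves as well and avoids
-- truncated subtraction.
after-parity : ∀ {m f} b → Parity m f → Parity (∣ b ∣θ + m) (after b f)
after-parity {m} {f} b f-par α = begin
  -1^ θdeg α * f (b ∷ α)
    ≡⟨ sym (*-identityˡ _) ⟩
  1ℚ * (-1^ θdeg α * f (b ∷ α))
    ≡⟨ cong (_* (-1^ θdeg α * f (b ∷ α))) (trans (sym (-1^-even ∣ b ∣θ)) (-1^-+ ∣ b ∣θ ∣ b ∣θ)) ⟩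
  -1^ ∣ b ∣θ * -1^ ∣ b ∣θ * (-1^ θdeg α * f (b ∷ α))
    ≡⟨ solve 4 (λ x y z w → (x :* y) :* (z :* w) := x :* ((y :* z) :* w)) refl
         (-1^ ∣ b ∣θ) (-1^ ∣ b ∣θ) (-1^ θdeg α) (f (b ∷ α)) ⟩
  -1^ ∣ b ∣θ * (-1^ ∣ b ∣θ * -1^ θdeg α * f (b ∷ α))
    ≡⟨ cong (λ x → -1^ ∣ b ∣θ * (x * f (b ∷ α))) (sym (-1^-+ ∣ b ∣θ (θdeg α))) ⟩
  -1^ ∣ b ∣θ * (-1^ θdeg (b ∷ α) * f (b ∷ α))
    ≡⟨ cong (-1^ ∣ b ∣θ *_) (f-par (b ∷ α)) ⟩
  -1^ ∣ b ∣θ * (-1^ m * f (b ∷ α))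
    ≡⟨ sym (*-assoc (-1^ ∣ b ∣θ) (-1^ m) (f (b ∷ α))) ⟩
  -1^ ∣ b ∣θ * -1^ m * f (b ∷ α)
    ≡⟨ cong (_* f (b ∷ α)) (sym (-1^-+ ∣ b ∣θ m)) ⟩
  -1^ (∣ b ∣θ + m) * f (b ∷ α) ∎

-1^-absorb : ∀ m n {x} → x ≡ -1^ m * x → x ≡ -1^ (n ℕ.* m) * x
-1^-absorb m zero    {x} e = sym (*-identityˡ x)
-1^-absorb m (suc n) {x} e = begin
  x                               ≡⟨ e ⟩
  -1^ m * x                       ≡⟨ cong (-1^ m *_) (-1^-absorb m n e) ⟩
  -1^ m * (-1^ (n ℕ.* m) * x)     ≡⟨ sym (*-assoc (-1^ m) (-1^ (n ℕ.* m)) x) ⟩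
  -1^ m * -1^ (n ℕ.* m) * x       ≡⟨ cong (_* x) (sym (-1^-+ m (n ℕ.* m))) ⟩
  -1^ (m + n ℕ.* m) * x           ∎

-- A power contains at most one θ, so at most one of its two factors does, and exchanging them costs
-- no sign.
split-disjoint : ∀ a b c → ∣ b ∣θ + ∣ c ∣θ ≡ ∣ a ∣θ → ∣ b ∣θ ℕ.* ∣ c ∣θ ≡ 0
split-disjoint a           (_ , false) c           _ = refl
split-disjoint a           (_ , true)  (_ , false) _ = refl
split-disjoint (_ , false) (_ , true)  (_ , true)  ()
split-disjoint (_ , true)  (_ , true)  (_ , true)  ()

⊛-comm : ∀ {m n f g} → Parity m f → Parity n g → ∀ α → (f ⊛ g) α ≡ -1^ (m ℕ.* n) * (g ⊛ f) α
⊛-comm {m} {n} {f} {g} f-par g-par [] = begin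
  1ℚ * (f [] * g []) ℚ.+ 0ℚ
    -- The constant term of `f` is 0 unless `m` is even, so it absorbs the sign.
    ≡⟨ cong (λ x → 1ℚ * (x * g []) ℚ.+ 0ℚ) (-1^-absorb m n (trans (sym (*-identityˡ (f []))) (f-par []))) ⟩
  1ℚ * (-1^ (n ℕ.* m) * f [] * g []) ℚ.+ 0ℚ
    ≡⟨ cong (λ k → 1ℚ * (-1^ k * f [] * g []) ℚ.+ 0ℚ) (ℕ.*-comm n m) ⟩
  1ℚ * (-1^ (m ℕ.* n) * f [] * g []) ℚ.+ 0ℚ
    ≡⟨ solve 3 (λ k x y → con 1ℚ :* (k :* x :* y) :+ con 0ℚ := k :* (con 1ℚ :* (y :* x) :+ con 0ℚ)) refl
         (-1^ (m ℕ.* n)) (f []) (g []) ⟩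
  -1^ (m ℕ.* n) * (1ℚ * (g [] * f []) ℚ.+ 0ℚ) ∎
⊛-comm {m} {n} {f} {g} f-par g-par (a ∷ α) = begin
  (f ⊛ g) (a ∷ α)
    ≡⟨ ⊛-∷ f g a α ⟩
  ∑ (split a) (λ (b , c) → (twist c (after b f) ⊛ after c g) α)
    ≡⟨ ∑-cong (split a) (All.map (λ {(b , c)} (_ , q) → commute b c q) (split-degrees a)) ⟩
  ∑ (split a) (λ (b , c) → -1^ (m ℕ.* n) * (twist b (after c g) ⊛ after b f) α)
    ≡⟨ ∑-* (-1^ (m ℕ.* n)) (split a) (λ (b , c) → (twist b (after c g) ⊛ after b f) α) ⟩
  -1^ (m ℕ.* n) * ∑ (split a) (λ (b , c) → (twist b (after c g) ⊛ after b f) α)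
    ≡⟨ cong (-1^ (m ℕ.* n) *_) (∑-split-flip a (λ b c → (twist b (after c g) ⊛ after b f) α)) ⟩
  -1^ (m ℕ.* n) * ∑ (split a) (λ (b , c) → (twist c (after b g) ⊛ after c f) α)
    ≡⟨ cong (-1^ (m ℕ.* n) *_) (sym (⊛-∷ g f a α)) ⟩
  -1^ (m ℕ.* n) * (g ⊛ f) (a ∷ α) ∎
  where
  untwist : ∀ {m f} → Parity m f → ∀ g b c →
    (twist c (after b f) ⊛ g) α ≡ -1^ (∣ c ∣θ ℕ.* (∣ b ∣θ + m)) * (after b f ⊛ g) α
  untwist {m} {f} f-par g b c = trans
    (⊛-cong {g = g} (twist-parity {∣ b ∣θ + m} c (after-parity {m} b f-par)) (λ _ → refl) α)
    (⊛-scaleˡ k (after b f) g α)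
    where k = -1^ (∣ c ∣θ ℕ.* (∣ b ∣θ + m))

  parity : ∀ b c m n → c ℕ.* (b + m) + (b + m) ℕ.* (c + n) ≡
           m ℕ.* n + b ℕ.* n + (c ℕ.* (b + m) + c ℕ.* (b + m))
  parity = solve-∀

  parity′ : ∀ b c m n → m ℕ.* n + b ℕ.* n + b ℕ.* c ≡ m ℕ.* n + b ℕ.* (c + n)
  parity′ = solve-∀

  commute : ∀ b c → ∣ b ∣θ + ∣ c ∣θ ≡ ∣ a ∣θ →
    (twist c (after b f) ⊛ after c g) α ≡ -1^ (m ℕ.* n) * (twist b (after c g) ⊛ after b f) α
  commute b c q = begin
    (twist c (after b f) ⊛ after c g) α
      ≡⟨ untwist f-par (after c g) b c ⟩
    -1^ k * (after b f ⊛ after c g) α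
      ≡⟨ cong (-1^ k *_) (⊛-comm {∣ b ∣θ + m} {∣ c ∣θ + n} (after-parity {m} b f-par) (after-parity {n} c g-par) α) ⟩
    -1^ k * (-1^ l * y)
      ≡⟨ sym (*-assoc (-1^ k) (-1^ l) y) ⟩
    -1^ k * -1^ l * y
      ≡⟨ cong (_* y) (sym (-1^-+ k l)) ⟩
    -1^ (k + l) * y
      ≡⟨ cong (λ i → -1^ i * y) (parity ∣ b ∣θ ∣ c ∣θ m n) ⟩
    -1^ (m ℕ.* n + ∣ b ∣θ ℕ.* n + (k + k)) * y
      ≡⟨ cong (_* y) (trans (-1^-+ (m ℕ.* n + ∣ b ∣θ ℕ.* n) (k + k))
           (trans (cong (-1^ (m ℕ.* n + ∣ b ∣θ ℕ.* n) *_) (-1^-even k)) (*-identityʳ (-1^ (m ℕ.* n + ∣ b ∣θ ℕ.* n))))) ⟩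
    -1^ (m ℕ.* n + ∣ b ∣θ ℕ.* n) * y
      -- Inserting the product of the θ-degrees of `b` and `c`, which is 0, completes the exponent
      -- to `j`, the one that `untwist` produces for the exchanged factors.
      ≡⟨ cong (λ i → -1^ i * y) (trans (sym (ℕ.+-identityʳ _))
           (cong (m ℕ.* n + ∣ b ∣θ ℕ.* n +_) (sym (split-disjoint a b c q)))) ⟩
    -1^ (m ℕ.* n + ∣ b ∣θ ℕ.* n + ∣ b ∣θ ℕ.* ∣ c ∣θ) * y
      ≡⟨ cong (λ i → -1^ i * y) (parity′ ∣ b ∣θ ∣ c ∣θ m n) ⟩
    -1^ (m ℕ.* n + j) * y
      ≡⟨ cong (_* y) (-1^-+ (m ℕ.* n) j) ⟩
    -1^ (m ℕ.* n) * -1^ j * y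
      ≡⟨ *-assoc (-1^ (m ℕ.* n)) (-1^ j) y ⟩
    -1^ (m ℕ.* n) * (-1^ j * y)
      ≡⟨ cong (-1^ (m ℕ.* n) *_) (sym (untwist g-par (after b f) c b)) ⟩
    -1^ (m ℕ.* n) * (twist b (after c g) ⊛ after b f) α ∎
    where
    k = ∣ c ∣θ ℕ.* (∣ b ∣θ + m)
    l = (∣ b ∣θ + m) ℕ.* (∣ c ∣θ + n)
    j = ∣ b ∣θ ℕ.* (∣ c ∣θ + n)
    y = (after c g ⊛ after b f) α

-- The unit, and multiplication by a power sum

one-⊛ : ∀ f → one ⊛ f ≗ f
one-⊛ f []      = solve 1 (λ x → con 1ℚ :* (con 1ℚ :* x) :+ con 0ℚ := x) refl (f [])
one-⊛ f (a ∷ α) = begin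
  (one ⊛ f) (a ∷ α)
    ≡⟨ ⊛-∷ one f a α ⟩
  ∑ (split a) (λ (b , c) → (twist c (after b one) ⊛ after c f) α)
    ≡⟨ ∑-ext (split a) (λ (b , c) → trans
         (⊛-cong {g = after c f} (twist-one b c) (λ _ → refl) α)
         (trans (⊛-scaleˡ (δ b x^0) one (after c f) α) (cong (δ b x^0 *_) (one-⊛ (after c f) α)))) ⟩
  ∑ (split a) (λ (b , c) → δ b x^0 * f (c ∷ α))
    ≡⟨ ∑-split-unitˡ a (λ b c → f (c ∷ α)) ⟩
  f (a ∷ α) ∎
  where
  twist-one : ∀ b c β → twist c (after b one) β ≡ δ b x^0 * one β
  twist-one b c β = begin
    -1^ (∣ c ∣θ ℕ.* θdeg β) * (δ b x^0 * one β)
      ≡⟨ *-exchange (-1^ (∣ c ∣θ ℕ.* θdeg β)) (δ b x^0) (one β) ⟩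
    δ b x^0 * twist c one β
      ≡⟨ cong (δ b x^0 *_) (trans (twist-parity c one-parity β)
           (trans (cong (λ n → -1^ n * one β) (ℕ.*-zeroʳ ∣ c ∣θ)) (*-identityˡ (one β)))) ⟩
    δ b x^0 * one β ∎

⊛-one : ∀ f → f ⊛ one ≗ f
⊛-one f []      = solve 1 (λ x → con 1ℚ :* (x :* con 1ℚ) :+ con 0ℚ := x) refl (f [])
⊛-one f (a ∷ α) = begin
  (f ⊛ one) (a ∷ α)
    ≡⟨ ⊛-∷ f one a α ⟩
  ∑ (split a) (λ (b , c) → (twist c (after b f) ⊛ after c one) α)
    ≡⟨ ∑-ext (split a) (λ (b , c) → trans
         (⊛-scaleʳ (δ c x^0) (twist c (after b f)) one α)
         (cong (δ c x^0 *_) (⊛-one (twist c (after b f)) α))) ⟩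
  ∑ (split a) (λ (b , c) → δ c x^0 * twist c (after b f) α)
    ≡⟨ ∑-split-unitʳ a (λ b c → twist c (after b f) α) ⟩
  1ℚ * f (a ∷ α)
    ≡⟨ *-identityˡ (f (a ∷ α)) ⟩
  f (a ∷ α) ∎

-- The summand taken from the power sum lies either in the first pair of variables or in a later
-- one. In the latter case all of `a` comes from `h` and has to pass `ℓ` to reach the front, which
-- gives the sign.
powerSum-⊛-∷ : ∀ ℓ h a α → (powerSum ℓ ⊛ h) (a ∷ α) ≡
  ∑ (split a) (λ (b , c) → δ b ℓ * h (c ∷ α)) ℚ.+ -1^ (∣ a ∣θ ℕ.* ∣ ℓ ∣θ) * (powerSum ℓ ⊛ after a h) α
powerSum-⊛-∷ ℓ h a α = begin
  (powerSum ℓ ⊛ h) (a ∷ α)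
    ≡⟨ ⊛-∷ (powerSum ℓ) h a α ⟩
  ∑ (split a) (λ (b , c) → (twist c (after b (powerSum ℓ)) ⊛ after c h) α)
    ≡⟨ ∑-ext (split a) (λ (b , c) → term b c) ⟩
  ∑ (split a) (λ (b , c) → δ b ℓ * h (c ∷ α) ℚ.+ δ b x^0 * rest c)
    ≡⟨ ∑-+ (split a) (λ (b , c) → δ b ℓ * h (c ∷ α)) (λ (b , c) → δ b x^0 * rest c) ⟩
  ∑ (split a) (λ (b , c) → δ b ℓ * h (c ∷ α)) ℚ.+ ∑ (split a) (λ (b , c) → δ b x^0 * rest c)
    ≡⟨ cong (∑ (split a) (λ (b , c) → δ b ℓ * h (c ∷ α)) ℚ.+_) (∑-split-unitˡ a (λ b c → rest c)) ⟩
  ∑ (split a) (λ (b , c) → δ b ℓ * h (c ∷ α)) ℚ.+ rest a ∎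
  where
  rest : Power → ℚ
  rest c = -1^ (∣ c ∣θ ℕ.* ∣ ℓ ∣θ) * (powerSum ℓ ⊛ after c h) α

  term : ∀ b c → (twist c (after b (powerSum ℓ)) ⊛ after c h) α ≡
                 δ b ℓ * h (c ∷ α) ℚ.+ δ b x^0 * rest c
  term b c = begin
    (twist c (after b (powerSum ℓ)) ⊛ after c h) α
      ≡⟨ ⊛-cong {g = after c h} expand (λ _ → refl) α ⟩
    ((λ β → δ b ℓ * one β ℚ.+ δ b x^0 * s * powerSum ℓ β) ⊛ after c h) α
      ≡⟨ ⊛-linearˡ (δ b ℓ) (δ b x^0 * s) one (powerSum ℓ) (after c h) α ⟩
    δ b ℓ * (one ⊛ after c h) α ℚ.+ δ b x^0 * s * (powerSum ℓ ⊛ after c h) α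
      ≡⟨ cong₂ ℚ._+_ (cong (δ b ℓ *_) (one-⊛ (after c h) α))
           (*-assoc (δ b x^0) s ((powerSum ℓ ⊛ after c h) α)) ⟩
    δ b ℓ * h (c ∷ α) ℚ.+ δ b x^0 * rest c ∎
    where
    s = -1^ (∣ c ∣θ ℕ.* ∣ ℓ ∣θ)
    expand : ∀ β → twist c (after b (powerSum ℓ)) β ≡ δ b ℓ * one β ℚ.+ δ b x^0 * s * powerSum ℓ β
    expand β = begin
      t * (δ b ℓ * one β ℚ.+ δ b x^0 * powerSum ℓ β)
        ≡⟨ solve 5 (λ t d o e p → t :* (d :* o :+ e :* p) := d :* (t :* o) :+ e :* (t :* p)) refl
             t (δ b ℓ) (one β) (δ b x^0) (powerSum ℓ β) ⟩
      δ b ℓ * twist c one β ℚ.+ δ b x^0 * twist c (powerSum ℓ) β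
        ≡⟨ cong₂ (λ x y → δ b ℓ * x ℚ.+ δ b x^0 * y)
             (trans (twist-parity c one-parity β)
               (trans (cong (λ n → -1^ n * one β) (ℕ.*-zeroʳ ∣ c ∣θ)) (*-identityˡ (one β))))
             (twist-parity c (powerSum-parity ℓ) β) ⟩
      δ b ℓ * one β ℚ.+ δ b x^0 * (s * powerSum ℓ β)
        ≡⟨ cong (δ b ℓ * one β ℚ.+_) (sym (*-assoc (δ b x^0) s (powerSum ℓ β))) ⟩
      δ b ℓ * one β ℚ.+ δ b x^0 * s * powerSum ℓ β ∎
      where t = -1^ (∣ c ∣θ ℕ.* θdeg β)

powerSum-⊛-[] : ∀ ℓ h → (powerSum ℓ ⊛ h) [] ≡ 0ℚ
powerSum-⊛-[] ℓ h = solve 1 (λ x → con 1ℚ :* (con 0ℚ :* x) :+ con 0ℚ := con 0ℚ) refl (h [])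

-- The first summand is the coefficient of α in the product with p ⊗ 1, the
-- second that of β in the product with 1 ⊗ p, after moving p past α.
powerSum-⊛-++ : ∀ ℓ h α β → (powerSum ℓ ⊛ h) (α ++ β) ≡
  (powerSum ℓ ⊛ (λ γ → h (γ ++ β))) α ℚ.+ -1^ (∣ ℓ ∣θ ℕ.* θdeg α) * (powerSum ℓ ⊛ (λ γ → h (α ++ γ))) β
powerSum-⊛-++ ℓ h []      β = sym (begin
  x ℚ.+ -1^ (∣ ℓ ∣θ ℕ.* 0) * y   ≡⟨ cong₂ (λ x k → x ℚ.+ -1^ k * y) (powerSum-⊛-[] ℓ (λ γ → h (γ ++ β))) (ℕ.*-zeroʳ ∣ ℓ ∣θ) ⟩
  0ℚ ℚ.+ 1ℚ * y                  ≡⟨ trans (ℚ.+-identityˡ _) (*-identityˡ y) ⟩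
  y                              ∎)
  where
  x = (powerSum ℓ ⊛ (λ γ → h (γ ++ β))) []
  y = (powerSum ℓ ⊛ h) β
powerSum-⊛-++ ℓ h (a ∷ α) β = begin
  (powerSum ℓ ⊛ h) (a ∷ α ++ β)
    ≡⟨ powerSum-⊛-∷ ℓ h a (α ++ β) ⟩
  d ℚ.+ s * (powerSum ℓ ⊛ after a h) (α ++ β)
    ≡⟨ cong (λ z → d ℚ.+ s * z) (powerSum-⊛-++ ℓ (after a h) α β) ⟩
  d ℚ.+ s * (x ℚ.+ t * y)
    ≡⟨ solve 5 (λ d s x t y → d :+ s :* (x :+ t :* y) := (d :+ s :* x) :+ (s :* t) :* y) refl d s x t y ⟩
  d ℚ.+ s * x ℚ.+ s * t * y
    ≡⟨ cong₂ (λ u k → u ℚ.+ k * y) (sym (powerSum-⊛-∷ ℓ (λ γ → h (γ ++ β)) a α))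
         (trans (sym (-1^-+ (∣ a ∣θ ℕ.* ∣ ℓ ∣θ) (∣ ℓ ∣θ ℕ.* θdeg α)))
           (cong -1^_ (distrib ∣ a ∣θ ∣ ℓ ∣θ (θdeg α)))) ⟩
  (powerSum ℓ ⊛ (λ γ → h (γ ++ β))) (a ∷ α) ℚ.+ -1^ (∣ ℓ ∣θ ℕ.* (∣ a ∣θ + θdeg α)) * y ∎
  where
  d = ∑ (split a) (λ (b , c) → δ b ℓ * h (c ∷ α ++ β))
  s = -1^ (∣ a ∣θ ℕ.* ∣ ℓ ∣θ)
  t = -1^ (∣ ℓ ∣θ ℕ.* θdeg α)
  x = (powerSum ℓ ⊛ (λ γ → h (a ∷ γ ++ β))) α
  y = (powerSum ℓ ⊛ (λ γ → h (a ∷ α ++ γ))) β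

  distrib : ∀ a l n → a ℕ.* l + l ℕ.* n ≡ l ℕ.* (a + n)
  distrib = solve-∀

-- Generators

-- `even r` stands for the power sum of exponent r + 1, so that no generator belongs to the excluded
-- power `x^0`.
data Generator : Set where
  even odd : ℕ → Generator

power : Generator → Power
power (even r) = suc r , false
power (odd k)  = k , true

power≢x^0 : ∀ g → x^0 ≢ power g
power≢x^0 (even _) ()
power≢x^0 (odd _)  ()

-- Built uniformly instead of by cases from `p` and `p~`, so that its coefficients compute to
-- `powerSum (power g)` for a variable `g`.
gen : Generator → Λ
gen g = record
  { coeff     = powerSum (power g)
  ; stable    = powerSum-stable (power g) (power≢x^0 g)
  ; symmetric = powerSum-symmetric (power g)
  ; bounded   = _ , powerSum-vanishes (power g)
  }

prod : List Generator → Λ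
prod []      = 𝟙
prod (g ∷ G) = gen g ⊠ prod G

-- Elements of Λ carry proofs and are compared by coefficients only, hence the constructor `resp`.
data Span : Λ → Set where
  product : ∀ G → Span (prod G)
  sum     : ∀ {f g} → Span f → Span g → Span (f ⊞ g)
  scale   : ∀ k {f} → Span f → Span (k • f)
  resp    : ∀ {f g} → f ≈ g → Span f → Span g

⊠-span : ∀ g {f} → Span f → Span (gen g ⊠ f)
⊠-span g (product G) = product (g ∷ G)
⊠-span g (sum {f} {h} s t) = resp
  (λ α → sym (begin
    (coeff (gen g) ⊛ coeff (f ⊞ h)) α
      ≡⟨ ⊛-cong {f = coeff (gen g)} {g = coeff (f ⊞ h)} {g′ = λ β → ∑ (f ∷ h ∷ []) (λ e → coeff e β)} (λ _ → refl)
           (λ β → cong (coeff f β ℚ.+_) (sym (ℚ.+-identityʳ (coeff h β)))) α ⟩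
    (coeff (gen g) ⊛ (λ β → ∑ (f ∷ h ∷ []) (λ e → coeff e β))) α
      ≡⟨ ⊛-∑ʳ (f ∷ h ∷ []) (coeff (gen g)) coeff α ⟩
    coeff (gen g ⊠ f) α ℚ.+ (coeff (gen g ⊠ h) α ℚ.+ 0ℚ)
      ≡⟨ cong (coeff (gen g ⊠ f) α ℚ.+_) (ℚ.+-identityʳ (coeff (gen g ⊠ h) α)) ⟩
    coeff (gen g ⊠ f) α ℚ.+ coeff (gen g ⊠ h) α ∎))
  (sum (⊠-span g s) (⊠-span g t))
⊠-span g (scale k {f} s) = resp
  (λ α → sym (⊛-scaleʳ k (coeff (gen g)) (coeff f) α))
  (scale k (⊠-span g s))
⊠-span g (resp e s) = resp (⊛-cong {f = coeff (gen g)} (λ _ → refl) e) (⊠-span g s)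

-- Every symmetric function is a polynomial in the power sums

size : Power → ℕ
size a = ∣ a ∣ₓ + ∣ a ∣θ

nontrivial : Power → ℕ
nontrivial (_     , true)  = 1
nontrivial (zero  , false) = 0
nontrivial (suc _ , false) = 1

-- `rank` counts the pairs of variables that occur. `degree` is total plus fermionic degree, put in
-- the form of a `weight` so that the lemmas on weights apply.
degree rank : Monomial → ℕ
degree = weight size
rank   = weight nontrivial

degree-≡ : ∀ α → xdeg α + θdeg α ≡ degree α
degree-≡ []      = refl
degree-≡ (a ∷ α) = trans (deg-∷ a α) (cong (size a +_) (degree-≡ α))

VanishesAbove : (Monomial → ℕ) → ℕ → Coefficients → Set
VanishesAbove w d f = ∀ α → d ℕ.< w α → f α ≡ 0ℚ

after-vanishes : ∀ {v d f} b → VanishesAbove (weight v) d f → VanishesAbove (weight v) d (after b f)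
after-vanishes b f-van α d<α = f-van (b ∷ α) (ℕ.<-≤-trans d<α (ℕ.m≤n+m _ _))

-- Sums over generators and the Euler operator

fromℕ : ℕ → ℚ
fromℕ zero    = 0ℚ
fromℕ (suc n) = 1ℚ ℚ.+ fromℕ n

fromℕ-nonNeg : ∀ n → ℚ.NonNegative (fromℕ n)
fromℕ-nonNeg zero    = _
fromℕ-nonNeg (suc n) = ℚ.nonNeg+nonNeg⇒nonNeg 1ℚ (fromℕ n) {{fromℕ-nonNeg n}}

fromℕ-nonZero : ∀ n → ℚ.NonZero (fromℕ (suc n))
fromℕ-nonZero n = ℚ.pos⇒nonZero (fromℕ (suc n)) {{ℚ.pos+nonNeg⇒pos 1ℚ (fromℕ n) {{fromℕ-nonNeg n}}}}

δ-refl : ∀ a → δ a a ≡ 1ℚ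
δ-refl a with a ≟ₚ a
... | yes _   = refl
... | no  a≢a = contradiction refl a≢a

-- For `i` beyond the range of summation both sides are 0. This is how bounded degree makes a finite
-- list of generators suffice.
∑-δ : ∀ d (e : ℕ → Power) → (∀ {i j} → e i ≡ e j → i ≡ j) →
      ∀ (F : ℕ → ℚ) → (∀ j → d ℕ.≤ j → F j ≡ 0ℚ) →
      ∀ i → ∑ (upTo d) (λ j → δ (e i) (e j) * F j) ≡ F i
∑-δ zero    e inj F F0 i = sym (F0 i ℕ.z≤n)
∑-δ (suc d) e inj F F0 i = trans
  (cong (δ (e i) (e 0) * F 0 ℚ.+_) (trans
    (cong (λ js → ∑ js (λ j → δ (e i) (e j) * F j)) (sym (map-upTo suc d)))
    (∑-map suc (upTo d) (λ j → δ (e i) (e j) * F j))))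
  (go i)
  where
  go : ∀ i → δ (e i) (e 0) * F 0 ℚ.+ ∑ (upTo d) (λ j → δ (e i) (e (suc j)) * F (suc j)) ≡ F i
  go zero = trans
    (cong₂ ℚ._+_ (trans (cong (_* F 0) (δ-refl (e 0))) (*-identityˡ (F 0)))
      (∑-zero (upTo d) (All.universal
        (λ j → trans (cong (_* F (suc j)) (δ-≢ (e 0) (e (suc j)) λ e≡ → ℕ.0≢1+n (inj e≡))) (*-zeroˡ (F (suc j))))
        (upTo d))))
    (ℚ.+-identityʳ (F 0))
  go (suc i) = trans
    (cong₂ ℚ._+_ (trans (cong (_* F 0) (δ-≢ (e (suc i)) (e 0) λ e≡ → ℕ.0≢1+n (sym (inj e≡)))) (*-zeroˡ (F 0)))
      (∑-δ d (e ∘ suc) (ℕ.suc-injective ∘ inj) (F ∘ suc) (λ j d≤j → F0 (suc j) (ℕ.s≤s d≤j)) i))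
    (ℚ.+-identityˡ (F (suc i)))

-- Exactly the generators of size 1 to `d`: both `even j` and `odd j` have size j + 1.
generators : ℕ → List Generator
generators d = map even (upTo d) ++ map odd (upTo d)

∑-generators : ∀ d (F : Power → ℚ) → (∀ b → d ℕ.< size b → F b ≡ 0ℚ) → ∀ b →
  ∑ (generators d) (λ g → δ b (power g) * F (power g)) ≡ fromℕ (nontrivial b) * F b
∑-generators d F F0 b = begin
  ∑ (generators d) term
    ≡⟨ ∑-++ (map even (upTo d)) (map odd (upTo d)) term ⟩
  ∑ (map even (upTo d)) term ℚ.+ ∑ (map odd (upTo d)) term
    ≡⟨ cong₂ ℚ._+_ (∑-map even (upTo d) term) (∑-map odd (upTo d) term) ⟩
  ∑ (upTo d) (term ∘ even) ℚ.+ ∑ (upTo d) (term ∘ odd)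
    ≡⟨ go b ⟩
  fromℕ (nontrivial b) * F b ∎
  where
  term : Generator → ℚ
  term g = δ b (power g) * F (power g)

  other : ∀ b (e : ℕ → Power) → (∀ j → b ≢ e j) → ∑ (upTo d) (λ j → δ b (e j) * F (e j)) ≡ 0ℚ
  other b e b≢e = ∑-zero (upTo d) (All.universal
    (λ j → trans (cong (_* F (e j)) (δ-≢ b (e j) (b≢e j))) (*-zeroˡ (F (e j)))) (upTo d))

  evens : ∀ i → ∑ (upTo d) (λ j → δ (suc i , false) (suc j , false) * F (suc j , false)) ≡ F (suc i , false)
  evens = ∑-δ d (λ j → suc j , false) (λ { refl → refl }) (λ j → F (suc j , false))
    (λ j d≤j → F0 (suc j , false) (ℕ.s≤s (ℕ.≤-trans d≤j (ℕ.m≤m+n j 0))))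

  odds : ∀ i → ∑ (upTo d) (λ j → δ (i , true) (j , true) * F (j , true)) ≡ F (i , true)
  odds = ∑-δ d (_, true) (λ { refl → refl }) (λ j → F (j , true))
    (λ j d≤j → F0 (j , true) (ℕ.≤-<-trans d≤j (ℕ.m<m+n j (ℕ.s≤s ℕ.z≤n))))

  go : ∀ b → ∑ (upTo d) (λ j → δ b (power (even j)) * F (power (even j))) ℚ.+
             ∑ (upTo d) (λ j → δ b (power (odd j)) * F (power (odd j))) ≡ fromℕ (nontrivial b) * F b
  go (zero  , false) = trans (cong₂ ℚ._+_ (other x^0 (power ∘ even) λ _ ()) (other x^0 (power ∘ odd) λ _ ()))
    (sym (*-zeroˡ (F x^0)))
  go (suc i , false) = trans (cong₂ ℚ._+_ (evens i) (other (suc i , false) (power ∘ odd) λ _ ()))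
    (trans (ℚ.+-identityʳ (F (suc i , false))) (sym (*-identityˡ (F (suc i , false)))))
  go (i     , true)  = trans (cong₂ ℚ._+_ (other (i , true) (power ∘ even) λ _ ()) (odds i))
    (trans (ℚ.+-identityˡ (F (i , true))) (sym (*-identityˡ (F (i , true)))))

-- Stability concerns trailing factors only; symmetry carries `x^0` to the end, without a sign as it
-- contains no θ.
∷-x^0 : ∀ {f} → Symmetric f → Stable f → ∀ α → f (x^0 ∷ α) ≡ f α
∷-x^0         f-sym f-st []      = f-st []
∷-x^0 {f} f-sym f-st (b ∷ α) = begin
  f (x^0 ∷ b ∷ α)   ≡⟨ trans (f-sym (swap x^0 b ↭.refl)) (*-identityˡ (f (b ∷ x^0 ∷ α))) ⟩
  f (b ∷ x^0 ∷ α)   ≡⟨ ∷-x^0 (after-symmetric b f-sym) (after-stable b f-st) α ⟩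
  f (b ∷ α)         ∎

-- Modelled on Euler's operator ∑ x ∂/∂x, which multiplies by the degree. As `after` is in general
-- not a derivation, multiplication by the rank survives only on monomials of top rank.
euler : List Generator → Coefficients → Coefficients
euler L f α = ∑ L (λ g → (powerSum (power g) ⊛ after (power g) f) α)

-- The sign in `powerSum-⊛-∷` cancels the one from exchanging `a` with the power of the generator
-- inside the symmetric `f`. What remains is the same operator on `after a f`, which permits
-- induction along the monomial.
euler-∷ : ∀ L {f} → Symmetric f → ∀ a α → euler L f (a ∷ α) ≡
  ∑ (split a) (λ (b , c) → ∑ L (λ g → δ b (power g) * f (power g ∷ c ∷ α))) ℚ.+ euler L (after a f) α
euler-∷ L {f} f-sym a α = begin
  euler L f (a ∷ α)
    ≡⟨ ∑-ext L (λ g → trans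
         (powerSum-⊛-∷ (power g) (after (power g) f) a α)
         (cong (∑ (split a) (λ (b , c) → first g b c) ℚ.+_) (exchange (power g)))) ⟩
  ∑ L (λ g → ∑ (split a) (λ (b , c) → first g b c) ℚ.+ (powerSum (power g) ⊛ after (power g) (after a f)) α)
    ≡⟨ ∑-+ L (λ g → ∑ (split a) (λ (b , c) → first g b c)) _ ⟩
  ∑ L (λ g → ∑ (split a) (λ (b , c) → first g b c)) ℚ.+ euler L (after a f) α
    ≡⟨ cong (ℚ._+ euler L (after a f) α) (∑-swap L (split a) (λ g (b , c) → first g b c)) ⟩
  ∑ (split a) (λ (b , c) → ∑ L (λ g → first g b c)) ℚ.+ euler L (after a f) α ∎
  where
  first : Generator → Power → Power → ℚ
  first g b c = δ b (power g) * f (power g ∷ c ∷ α)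

  exchange : ∀ ℓ → -1^ (∣ a ∣θ ℕ.* ∣ ℓ ∣θ) * (powerSum ℓ ⊛ after a (after ℓ f)) α ≡
                   (powerSum ℓ ⊛ after ℓ (after a f)) α
  exchange ℓ = sym (trans
    (⊛-cong {f = powerSum ℓ} (λ _ → refl)
      (λ γ → trans (f-sym (swap a ℓ ↭.refl)) (cong (_* f (ℓ ∷ a ∷ γ)) (*-identityʳ s))) α)
    (⊛-scaleʳ s (powerSum ℓ) (after a (after ℓ f)) α))
    where s = -1^ (∣ a ∣θ ℕ.* ∣ ℓ ∣θ)

nontrivial-≢ : ∀ {b} → b ≢ x^0 → nontrivial b ≡ 1
nontrivial-≢ {_     , true}  _     = refl
nontrivial-≢ {zero  , false} b≢x^0 = contradiction refl b≢x^0
nontrivial-≢ {suc _ , false} _     = refl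

split-x^0 : ∀ {a b c} → ∣ b ∣ₓ + ∣ c ∣ₓ ≡ ∣ a ∣ₓ → ∣ b ∣θ + ∣ c ∣θ ≡ ∣ a ∣θ → b ≡ x^0 → c ≡ x^0 → a ≡ x^0
split-x^0 {zero , false} _ _ refl refl = refl

-- Splitting an entry of α between pₐ and ∂ₐ f into two nontrivial parts would
-- raise the rank, so each nontrivial entry contributes just f α.
euler-top : ∀ d k {f} → Symmetric f → Stable f → VanishesAbove degree d f → VanishesAbove rank k f →
  ∀ α → k ℕ.≤ rank α → euler (generators d) f α ≡ fromℕ (rank α) * f α
euler-top d k {f} f-sym f-st f-deg f-rank [] _ = trans
  (∑-zero (generators d) (All.universal (λ g → powerSum-⊛-[] (power g) (after (power g) f)) (generators d)))
  (sym (*-zeroˡ (f [])))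
euler-top d k {f} f-sym f-st f-deg f-rank (a ∷ α) k≤a∷α = begin
  euler L f (a ∷ α)
    ≡⟨ euler-∷ L f-sym a α ⟩
  ∑ (split a) (λ (b , c) → ∑ L (λ g → δ b (power g) * f (power g ∷ c ∷ α))) ℚ.+ euler L (after a f) α
    ≡⟨ cong (ℚ._+ euler L (after a f) α) (∑-ext (split a) λ (b , c) →
         ∑-generators d (λ b → f (b ∷ c ∷ α)) (λ b d<b → f-deg (b ∷ c ∷ α) (ℕ.<-≤-trans d<b (ℕ.m≤m+n _ _))) b) ⟩
  ∑ (split a) (λ (b , c) → fromℕ (nontrivial b) * f (b ∷ c ∷ α)) ℚ.+ euler L (after a f) α
    ≡⟨ main ⟩
  fromℕ (rank (a ∷ α)) * f (a ∷ α) ∎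
  where
  L = generators d

  main : ∑ (split a) (λ (b , c) → fromℕ (nontrivial b) * f (b ∷ c ∷ α)) ℚ.+ euler L (after a f) α ≡
         fromℕ (rank (a ∷ α)) * f (a ∷ α)
  main with a ≟ₚ x^0
  ... | yes refl = trans
    (cong₂ ℚ._+_
      (trans (ℚ.+-identityʳ _) (*-zeroˡ (f (x^0 ∷ x^0 ∷ α))))
      (euler-top d k (after-symmetric x^0 f-sym) (after-stable x^0 f-st)
        (after-vanishes {size} x^0 f-deg) (after-vanishes {nontrivial} x^0 f-rank) α k≤a∷α))
    (ℚ.+-identityˡ _)
  ... | no  a≢x^0 = begin
    ∑ (split a) (λ (b , c) → fromℕ (nontrivial b) * f (b ∷ c ∷ α)) ℚ.+ euler L (after a f) α
      ≡⟨ cong₂ ℚ._+_ leading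
           -- The nontrivial entry `a` uses up one unit of the rank bound; for k = 0 the predecessor
           -- is 0, which is still a valid bound.
           (euler-top d (ℕ.pred k) (after-symmetric a f-sym) (after-stable a f-st)
             (after-vanishes {size} a f-deg) (λ β k<β → f-rank (a ∷ β) (below β k<β)) α
             (ℕ.pred-mono-≤ (≡.subst (k ℕ.≤_) (rank-a∷ α) k≤a∷α))) ⟩
    f (a ∷ α) ℚ.+ fromℕ (rank α) * f (a ∷ α)
      ≡⟨ solve 2 (λ n x → x :+ n :* x := (con 1ℚ :+ n) :* x) refl (fromℕ (rank α)) (f (a ∷ α)) ⟩
    fromℕ (suc (rank α)) * f (a ∷ α)
      ≡⟨ cong (λ n → fromℕ n * f (a ∷ α)) (sym (rank-a∷ α)) ⟩
    fromℕ (rank (a ∷ α)) * f (a ∷ α) ∎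
    where
    rank-a∷ : ∀ β → rank (a ∷ β) ≡ suc (rank β)
    rank-a∷ β = cong (_+ rank β) (nontrivial-≢ a≢x^0)

    below : ∀ β → ℕ.pred k ℕ.< rank β → k ℕ.< rank (a ∷ β)
    below β lt = ≡.subst (k ℕ.<_) (sym (rank-a∷ β)) (ℕ.s≤s (ℕ.≤-trans (ℕ.m≤n+m∸n k 1) lt))

    only-x^0 : ∀ b c → ∣ b ∣ₓ + ∣ c ∣ₓ ≡ ∣ a ∣ₓ × ∣ b ∣θ + ∣ c ∣θ ≡ ∣ a ∣θ →
      fromℕ (nontrivial b) * f (b ∷ c ∷ α) ≡ δ c x^0 * f (b ∷ c ∷ α)
    only-x^0 b c (p , q) with b ≟ₚ x^0 | c ≟ₚ x^0
    ... | yes b≡ | yes c≡ = contradiction (split-x^0 p q b≡ c≡) a≢x^0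
    ... | yes refl | no _  = refl
    ... | no b≢  | yes _  = cong (λ n → fromℕ n * f (b ∷ c ∷ α)) (nontrivial-≢ b≢)
    ... | no b≢  | no c≢  = trans (cong (fromℕ (nontrivial b) *_) vanish)
      (trans (*-zeroʳ (fromℕ (nontrivial b))) (sym (trans (cong (0ℚ *_) vanish) (*-zeroʳ 0ℚ))))
      where
      vanish : f (b ∷ c ∷ α) ≡ 0ℚ
      vanish = f-rank (b ∷ c ∷ α) (≡.subst (k ℕ.<_)
        (sym (cong₂ (λ m n → m + (n + rank α)) (nontrivial-≢ b≢) (nontrivial-≢ c≢)))
        (ℕ.s≤s (≡.subst (k ℕ.≤_) (rank-a∷ α) k≤a∷α)))

    leading : ∑ (split a) (λ (b , c) → fromℕ (nontrivial b) * f (b ∷ c ∷ α)) ≡ f (a ∷ α)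
    leading = begin
      ∑ (split a) (λ (b , c) → fromℕ (nontrivial b) * f (b ∷ c ∷ α))
        ≡⟨ ∑-cong (split a) (All.map (λ {(b , c)} → only-x^0 b c) (split-degrees a)) ⟩
      ∑ (split a) (λ (b , c) → δ c x^0 * f (b ∷ c ∷ α))
        ≡⟨ ∑-split-unitʳ a (λ b c → f (b ∷ c ∷ α)) ⟩
      f (a ∷ x^0 ∷ α)
        ≡⟨ ∷-x^0 (after-symmetric a f-sym) (after-stable a f-st) α ⟩
      f (a ∷ α) ∎

-- Generation by the power sums, by induction on the rank

afterΛ : Power → Λ → Λ
afterΛ a f = record
  { coeff     = after a (coeff f)
  ; stable    = after-stable {coeff f} a (Λ.stable f)
  ; symmetric = after-symmetric {coeff f} a (Λ.symmetric f)
  ; bounded   = proj₁ (Λ.bounded f) , λ α lt → proj₂ (Λ.bounded f) (a ∷ α)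
      (ℕ.<-≤-trans lt (ℕ.+-mono-≤ (ℕ.m≤n+m _ ∣ a ∣ₓ) (ℕ.m≤n+m _ ∣ a ∣θ)))
  }

eulerΛ : List Generator → Λ → Λ
eulerΛ []      f = 𝟘
eulerΛ (g ∷ L) f = gen g ⊠ afterΛ (power g) f ⊞ eulerΛ L f

coeff-eulerΛ : ∀ L f α → coeff (eulerΛ L f) α ≡ euler L (coeff f) α
coeff-eulerΛ []      f α = *-zeroˡ (one α)
coeff-eulerΛ (g ∷ L) f α = cong ((powerSum (power g) ⊛ after (power g) (coeff f)) α ℚ.+_) (coeff-eulerΛ L f α)

rank≤degree : ∀ α → rank α ℕ.≤ degree α
rank≤degree []      = ℕ.z≤n
rank≤degree (a ∷ α) = ℕ.+-mono-≤ (nontrivial≤size a) (rank≤degree α)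
  where
  nontrivial≤size : ∀ a → nontrivial a ℕ.≤ size a
  nontrivial≤size (n     , true)  = ℕ.m≤n+m 1 n
  nontrivial≤size (zero  , false) = ℕ.z≤n
  nontrivial≤size (suc _ , false) = ℕ.s≤s ℕ.z≤n

constant : ∀ f → VanishesAbove rank 0 (coeff f) → f ≈ coeff f [] • 𝟙
constant f f-rank []      = sym (*-identityʳ (coeff f []))
constant f f-rank (a ∷ α) with a ≟ₚ x^0
... | yes refl = trans (∷-x^0 {coeff f} (Λ.symmetric f) (Λ.stable f) α)
  (trans (constant f f-rank α) (cong (coeff f [] *_) (sym (*-identityˡ (one α)))))
... | no a≢x^0 = trans
  (f-rank (a ∷ α) (≡.subst (0 ℕ.<_) (sym (cong (_+ rank α) (nontrivial-≢ a≢x^0))) (ℕ.s≤s ℕ.z≤n)))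
  (sym (trans (cong (coeff f [] *_) (*-zeroˡ (one α))) (*-zeroʳ (coeff f []))))

span-rank : ∀ k f → VanishesAbove rank k (coeff f) → Span f
span-rank zero    f f-rank = resp (sym ∘ constant f f-rank) (scale (coeff f []) (product []))
span-rank (suc k) f f-rank = resp recover (scale k⁻¹ (sum N-span (span-rank k h h-rank)))
  where
  instance
    k≢0 : ℚ.NonZero (fromℕ (suc k))
    k≢0 = fromℕ-nonZero k

  k⁻¹ = ℚ.1/ fromℕ (suc k)
  d = proj₁ (Λ.bounded f)
  N = eulerΛ (generators d) f
  -- On rank k + 1 the two terms cancel by the Euler identity, and on larger rank both are 0, so the
  -- rank bound drops to `k`.
  h = fromℕ (suc k) • f ⊞ ⊟ N

  euler-span : ∀ L → Span (eulerΛ L f)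
  euler-span []      = scale 0ℚ (product [])
  euler-span (g ∷ L) = sum
    (⊠-span g (span-rank k (afterΛ (power g) f) λ α k<α →
      f-rank (power g ∷ α) (≡.subst (suc k ℕ.<_)
        (sym (cong (_+ rank α) (nontrivial-≢ (power≢x^0 g ∘ sym)))) (ℕ.s≤s k<α))))
    (euler-span L)

  N-span : Span N
  N-span = euler-span (generators d)

  f-deg : VanishesAbove degree d (coeff f)
  f-deg α lt = proj₂ (Λ.bounded f) α (≡.subst (d ℕ.<_) (sym (degree-≡ α)) lt)

  N-top : ∀ α → suc k ℕ.≤ rank α → coeff N α ≡ fromℕ (rank α) * coeff f α
  N-top α lt = trans (coeff-eulerΛ (generators d) f α)
    (euler-top d (suc k) {coeff f} (Λ.symmetric f) (Λ.stable f) f-deg f-rank α lt)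

  N-rank : ∀ α → suc k ℕ.≤ rank α → coeff N α ≡ fromℕ (suc k) * coeff f α
  N-rank α k<α with ℕ.m≤n⇒m<n∨m≡n k<α
  ... | inj₂ k≡α = trans (N-top α k<α) (cong (λ n → fromℕ n * coeff f α) (sym k≡α))
  ... | inj₁ lt  = trans (N-top α k<α)
    (trans (cong (fromℕ (rank α) *_) (f-rank α lt)) (trans (*-zeroʳ (fromℕ (rank α)))
      (sym (trans (cong (fromℕ (suc k) *_) (f-rank α lt)) (*-zeroʳ (fromℕ (suc k)))))))

  h-rank : VanishesAbove rank k (coeff h)
  h-rank α k<α = trans (cong (λ x → fromℕ (suc k) * coeff f α ℚ.+ - 1ℚ * x) (N-rank α k<α))
    (solve 1 (λ x → x :+ con (- 1ℚ) :* x := con 0ℚ) refl (fromℕ (suc k) * coeff f α))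

  recover : k⁻¹ • (N ⊞ h) ≈ f
  recover α = begin
    k⁻¹ * (coeff N α ℚ.+ (fromℕ (suc k) * coeff f α ℚ.+ - 1ℚ * coeff N α))
      ≡⟨ solve 4 (λ i n k x → i :* (n :+ (k :* x :+ con (- 1ℚ) :* n)) := (i :* k) :* x) refl
           k⁻¹ (coeff N α) (fromℕ (suc k)) (coeff f α) ⟩
    k⁻¹ * fromℕ (suc k) * coeff f α
      ≡⟨ cong (_* coeff f α) (ℚ.*-inverseˡ (fromℕ (suc k))) ⟩
    1ℚ * coeff f α
      ≡⟨ *-identityˡ (coeff f α) ⟩
    coeff f α ∎

spanned : ∀ f → Span f
spanned f = span-rank (proj₁ (Λ.bounded f)) f λ α lt →
  proj₂ (Λ.bounded f) α (ℕ.<-≤-trans lt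
    (≡.subst (rank α ℕ.≤_) (sym (degree-≡ α)) (rank≤degree α)))

-- The antipode on products of power sums

parity : List Generator → ℕ
parity []      = 0
parity (g ∷ G) = ∣ power g ∣θ + parity G

prod-parity : ∀ G → Parity (parity G) (coeff (prod G))
prod-parity []      = one-parity
prod-parity (g ∷ G) = ⊛-parity {∣ power g ∣θ} {parity G} {powerSum (power g)} {coeff (prod G)}
  (powerSum-parity (power g)) (prod-parity G)

-- (k , A , B) stands for k (∏ A ⊗ ∏ B).
Term : Set
Term = ℚ × List Generator × List Generator

-- Multiplication from the left by g ⊗ 1 and by 1 ⊗ g; in the second case g has to pass ∏ A.
left right : Generator → Term → Term
left  g (k , A , B) = k , g ∷ A , B
right g (k , A , B) = k * -1^ (∣ power g ∣θ ℕ.* parity A) , A , g ∷ B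

-- The expansion of Δ (∏ G) = ∏ (g ⊗ 1 + 1 ⊗ g).
shuffles : List Generator → List Term
shuffles []      = (1ℚ , [] , []) ∷ []
shuffles (g ∷ G) = map (left g) (shuffles G) ++ map (right g) (shuffles G)

tensor : Term → Λ × Λ
tensor (k , A , B) = k • prod A , prod B

∑-shuffles : ∀ g G (F : Term → ℚ) → ∑ (shuffles (g ∷ G)) F ≡ ∑ (shuffles G) (λ t → F (left g t) ℚ.+ F (right g t))
∑-shuffles g G F = begin
  ∑ (map (left g) (shuffles G) ++ map (right g) (shuffles G)) F
    ≡⟨ ∑-++ (map (left g) (shuffles G)) (map (right g) (shuffles G)) F ⟩
  ∑ (map (left g) (shuffles G)) F ℚ.+ ∑ (map (right g) (shuffles G)) F
    ≡⟨ cong₂ ℚ._+_ (∑-map (left g) (shuffles G) F) (∑-map (right g) (shuffles G) F) ⟩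
  ∑ (shuffles G) (F ∘ left g) ℚ.+ ∑ (shuffles G) (F ∘ right g)
    ≡⟨ sym (∑-+ (shuffles G) (F ∘ left g) (F ∘ right g)) ⟩
  ∑ (shuffles G) (λ t → F (left g t) ℚ.+ F (right g t)) ∎

one-++ : ∀ α β → one (α ++ β) ≡ one α * one β
one-++ []      β = sym (*-identityˡ (one β))
one-++ (a ∷ α) β = trans (cong (δ a x^0 *_) (one-++ α β)) (sym (*-assoc (δ a x^0) (one α) (one β)))

Δ-prod′ : ∀ G α β → coeff (prod G) (α ++ β) ≡
          ∑ (shuffles G) (λ (k , A , B) → k * coeff (prod A) α * coeff (prod B) β)
Δ-prod′ []      α β = trans (one-++ α β)
  (solve 2 (λ x y → x :* y := con 1ℚ :* x :* y :+ con 0ℚ) refl (one α) (one β))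
Δ-prod′ (g ∷ G) α β = begin
  (pg ⊛ coeff (prod G)) (α ++ β)
    ≡⟨ powerSum-⊛-++ (power g) (coeff (prod G)) α β ⟩
  (pg ⊛ (λ γ → coeff (prod G) (γ ++ β))) α ℚ.+ s * (pg ⊛ (λ γ → coeff (prod G) (α ++ γ))) β
    ≡⟨ cong₂ (λ x y → x ℚ.+ s * y)
         (⊛-cong {f = pg} (λ _ → refl) (λ γ → Δ-prod′ G γ β) α)
         (⊛-cong {f = pg} (λ _ → refl) (λ γ → Δ-prod′ G α γ) β) ⟩
  (pg ⊛ (λ γ → ∑ T (λ t → F t γ β))) α ℚ.+ s * (pg ⊛ (λ γ → ∑ T (λ t → F t α γ))) β
    ≡⟨ cong₂ (λ x y → x ℚ.+ s * y)
         (⊛-∑ʳ T pg (λ t γ → F t γ β) α) (⊛-∑ʳ T pg (λ t γ → F t α γ) β) ⟩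
  ∑ T (λ t → (pg ⊛ (λ γ → F t γ β)) α) ℚ.+ s * ∑ T (λ t → (pg ⊛ (λ γ → F t α γ)) β)
    ≡⟨ cong (∑ T (λ t → (pg ⊛ (λ γ → F t γ β)) α) ℚ.+_) (sym (∑-* s T (λ t → (pg ⊛ (λ γ → F t α γ)) β))) ⟩
  ∑ T (λ t → (pg ⊛ (λ γ → F t γ β)) α) ℚ.+ ∑ T (λ t → s * (pg ⊛ (λ γ → F t α γ)) β)
    ≡⟨ sym (∑-+ T (λ t → (pg ⊛ (λ γ → F t γ β)) α) (λ t → s * (pg ⊛ (λ γ → F t α γ)) β)) ⟩
  ∑ T (λ t → (pg ⊛ (λ γ → F t γ β)) α ℚ.+ s * (pg ⊛ (λ γ → F t α γ)) β)
    ≡⟨ ∑-ext T (λ t → cong₂ ℚ._+_ (toLeft t) (toRight t)) ⟩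
  ∑ T (λ t → F (left g t) α β ℚ.+ F (right g t) α β)
    ≡⟨ sym (∑-shuffles g G (λ t → F t α β)) ⟩
  ∑ (shuffles (g ∷ G)) (λ t → F t α β) ∎
  where
  T = shuffles G
  pg = powerSum (power g)
  s = -1^ (∣ power g ∣θ ℕ.* θdeg α)

  F : Term → Coefficients²
  F (k , A , B) α β = k * coeff (prod A) α * coeff (prod B) β

  toLeft : ∀ t → (pg ⊛ (λ γ → F t γ β)) α ≡ F (left g t) α β
  toLeft (k , A , B) = begin
    (pg ⊛ (λ γ → k * coeff (prod A) γ * b)) α
      ≡⟨ ⊛-cong {f = pg} (λ _ → refl) (λ γ → exchange k (coeff (prod A) γ) b) α ⟩
    (pg ⊛ (λ γ → k * b * coeff (prod A) γ)) α
      ≡⟨ ⊛-scaleʳ (k * b) pg (coeff (prod A)) α ⟩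
    k * b * (pg ⊛ coeff (prod A)) α
      ≡⟨ sym (exchange k ((pg ⊛ coeff (prod A)) α) b) ⟩
    k * (pg ⊛ coeff (prod A)) α * b ∎
    where
    b = coeff (prod B) β
    exchange : ∀ k x y → k * x * y ≡ k * y * x
    exchange = solve 3 (λ k x y → k :* x :* y := k :* y :* x) refl

  toRight : ∀ t → s * (pg ⊛ (λ γ → F t α γ)) β ≡ F (right g t) α β
  toRight (k , A , B) = begin
    s * (pg ⊛ (λ γ → k * a * coeff (prod B) γ)) β
      ≡⟨ cong (s *_) (⊛-scaleʳ (k * a) pg (coeff (prod B)) β) ⟩
    s * (k * a * (pg ⊛ coeff (prod B)) β)
      ≡⟨ solve 4 (λ s k a y → s :* (k :* a :* y) := k :* (s :* a) :* y) refl s k a ((pg ⊛ coeff (prod B)) β) ⟩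
    k * (s * a) * (pg ⊛ coeff (prod B)) β
      -- The sign still depends on the monomial `α`; the parity of `prod A` makes it the constant
      -- stored in the term.
      ≡⟨ cong (λ x → k * x * (pg ⊛ coeff (prod B)) β) (twist-parity {parity A} (power g) (prod-parity A) α) ⟩
    k * (-1^ (∣ power g ∣θ ℕ.* parity A) * a) * (pg ⊛ coeff (prod B)) β
      ≡⟨ cong (_* (pg ⊛ coeff (prod B)) β) (sym (*-assoc k _ a)) ⟩
    k * -1^ (∣ power g ∣θ ℕ.* parity A) * a * (pg ⊛ coeff (prod B)) β ∎
    where a = coeff (prod A) α

Δ-prod : ∀ G → ⟦ map tensor (shuffles G) ⟧ ≈² Δ (prod G)
Δ-prod G α β = trans (∑-map tensor (shuffles G) (λ (f , g) → coeff f α * coeff g β)) (sym (Δ-prod′ G α β))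

-- Multiplying one term of the coproduct together restores the whole product: the sign `k` of a
-- shuffle is the sign of undoing it.
Factors : List Generator → Term → Set
Factors G (k , A , B) = ∀ α → k * (coeff (prod A) ⊛ coeff (prod B)) α ≡ coeff (prod G) α

left-factors : ∀ g {G} t → Factors G t → Factors (g ∷ G) (left g t)
left-factors g {G} (k , A , B) e α = begin
  k * ((pg ⊛ a) ⊛ b) α              ≡⟨ cong (k *_) (⊛-assoc pg a b α) ⟩
  k * (pg ⊛ (a ⊛ b)) α              ≡⟨ sym (⊛-scaleʳ k pg (a ⊛ b) α) ⟩
  (pg ⊛ (λ γ → k * (a ⊛ b) γ)) α    ≡⟨ ⊛-cong {f = pg} (λ _ → refl) e α ⟩
  (pg ⊛ coeff (prod G)) α           ∎
  where
  pg = powerSum (power g)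
  a  = coeff (prod A)
  b  = coeff (prod B)

-- Bringing g to the front past `prod A` by supercommutativity repeats the sign introduced by
-- `right`, and the two cancel; this reduces to the case of `left`.
right-factors : ∀ g {G} t → Factors G t → Factors (g ∷ G) (right g t)
right-factors g {G} (k , A , B) e α = begin
  k * -1^ n * (a ⊛ (pg ⊛ b)) α
    ≡⟨ cong (k * -1^ n *_) (sym (⊛-assoc a pg b α)) ⟩
  k * -1^ n * ((a ⊛ pg) ⊛ b) α
    ≡⟨ cong (k * -1^ n *_) (⊛-cong {f = a ⊛ pg} {g = b}
         (⊛-comm {parity A} {∣ power g ∣θ} (prod-parity A) (powerSum-parity (power g))) (λ _ → refl) α) ⟩
  k * -1^ n * ((λ β → -1^ (parity A ℕ.* ∣ power g ∣θ) * (pg ⊛ a) β) ⊛ b) α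
    ≡⟨ cong (k * -1^ n *_) (⊛-scaleˡ (-1^ (parity A ℕ.* ∣ power g ∣θ)) (pg ⊛ a) b α) ⟩
  k * -1^ n * (-1^ (parity A ℕ.* ∣ power g ∣θ) * ((pg ⊛ a) ⊛ b) α)
    ≡⟨ cong (λ i → k * -1^ n * (-1^ i * ((pg ⊛ a) ⊛ b) α)) (ℕ.*-comm (parity A) ∣ power g ∣θ) ⟩
  k * -1^ n * (-1^ n * ((pg ⊛ a) ⊛ b) α)
    ≡⟨ solve 3 (λ k s x → k :* s :* (s :* x) := (s :* s) :* (k :* x)) refl k (-1^ n) (((pg ⊛ a) ⊛ b) α) ⟩
  -1^ n * -1^ n * (k * ((pg ⊛ a) ⊛ b) α)
    ≡⟨ cong (_* (k * ((pg ⊛ a) ⊛ b) α)) (trans (sym (-1^-+ n n)) (-1^-even n)) ⟩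
  1ℚ * (k * ((pg ⊛ a) ⊛ b) α)
    ≡⟨ *-identityˡ (k * ((pg ⊛ a) ⊛ b) α) ⟩
  k * ((pg ⊛ a) ⊛ b) α
    ≡⟨ left-factors g {G} (k , A , B) e α ⟩
  (pg ⊛ coeff (prod G)) α ∎
  where
  n  = ∣ power g ∣θ ℕ.* parity A
  pg = powerSum (power g)
  a  = coeff (prod A)
  b  = coeff (prod B)

shuffles-factors : ∀ G → All (Factors G) (shuffles G)
shuffles-factors []      = (λ α → trans (*-identityˡ ((one ⊛ one) α)) (one-⊛ one α)) ∷ []
shuffles-factors (g ∷ G) = ++⁺
  (map⁺ (All.map (λ {t} → left-factors g {G} t) (shuffles-factors G)))
  (map⁺ (All.map (λ {t} → right-factors g {G} t) (shuffles-factors G)))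

order : Term → ℕ
order (_ , A , _) = length A

-- Isolates the term G ⊗ 1, the only one in which `S` meets the full product; all others fall under
-- the induction hypothesis.
shuffles-∷ : ∀ G → ∃[ T ] shuffles G ≡ (1ℚ , G , []) ∷ T × All (λ t → order t ℕ.< length G) T
shuffles-∷ []      = [] , refl , []
shuffles-∷ (g ∷ G) with T , e , T< ← shuffles-∷ G = map (left g) T ++ map (right g) ((1ℚ , G , []) ∷ T)
  , cong (λ T → map (left g) T ++ map (right g) T) e
  , ++⁺ (map⁺ (All.map ℕ.s≤s T<)) (ℕ.≤-refl ∷ map⁺ (All.map ℕ.m<n⇒m<1+n T<))

-- The first generator goes left or right, with opposite signs, so the terms cancel in pairs; only
-- the empty product survives, as it does under the counit.
∑-shuffles-order : ∀ G α → ∑ (shuffles G) (λ t → -1^ order t * coeff (prod G) α) ≡ ε (prod G) * one α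
∑-shuffles-order []      α = ℚ.+-identityʳ (1ℚ * one α)
∑-shuffles-order (g ∷ G) α = begin
  ∑ (shuffles (g ∷ G)) (λ t → -1^ order t * x)
    ≡⟨ ∑-shuffles g G (λ t → -1^ order t * x) ⟩
  ∑ (shuffles G) (λ t → -1^ suc (order t) * x ℚ.+ -1^ order t * x)
    ≡⟨ ∑-zero (shuffles G) (All.universal (λ t →
         solve 2 (λ s x → con (- 1ℚ) :* s :* x :+ s :* x := con 0ℚ) refl (-1^ order t) x) (shuffles G)) ⟩
  0ℚ
    ≡⟨ sym (*-zeroˡ (one α)) ⟩
  0ℚ * one α
    ≡⟨ cong (_* one α) (sym (powerSum-⊛-[] (power g) (coeff (prod G)))) ⟩
  ε (prod (g ∷ G)) * one α ∎
  where x = coeff (prod (g ∷ G)) α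

-- The antipode axiom solved on products of generators

module _ {S : Λ → Λ} (S-antipode : IsAntipode S) where

  open IsAntipode S-antipode using () renaming (isLinear to S-linear; left to S-left)
  open IsLinear S-linear using () renaming (⟦⟧-cong to S-cong; *ₗ-homo to S-•)

  private
    summand : Monomial → Term → ℚ
    summand α (k , A , B) = (coeff (S (k • prod A)) ⊛ coeff (prod B)) α

  mult-tensor : ∀ T α → coeff (mult ((S ⊗ id) (map tensor T))) α ≡ ∑ T (summand α)
  mult-tensor []                α = *-zeroˡ (one α)
  mult-tensor ((k , A , B) ∷ T) α = cong (summand α (k , A , B) ℚ.+_) (mult-tensor T α)

  antipode-convolution : ∀ G α → ∑ (shuffles G) (summand α) ≡ ε (prod G) * one α
  antipode-convolution G α = trans (sym (mult-tensor (shuffles G) α))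
    (S-left (prod G) (map tensor (shuffles G)) (Δ-prod G) α)

  summand-top : ∀ G α → summand α (1ℚ , G , []) ≡ coeff (S (prod G)) α
  summand-top G α = trans (⊛-one (coeff (S (1ℚ • prod G))) α)
    (S-cong {1ℚ • prod G} {prod G} (λ β → *-identityˡ (coeff (prod G) β)) α)

  summand-factors : ∀ G α t → S (prod (proj₁ (proj₂ t))) ≈ -1^ order t • prod (proj₁ (proj₂ t)) →
    Factors G t → summand α t ≡ -1^ order t * coeff (prod G) α
  summand-factors G α (k , A , B) S-A factors = begin
    (coeff (S (k • prod A)) ⊛ b) α
      ≡⟨ ⊛-cong {g = b} (S-• k (prod A)) (λ _ → refl) α ⟩
    ((λ β → k * coeff (S (prod A)) β) ⊛ b) α
      ≡⟨ ⊛-scaleˡ k (coeff (S (prod A))) b α ⟩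
    k * (coeff (S (prod A)) ⊛ b) α
      ≡⟨ cong (k *_) (⊛-cong {g = b} S-A (λ _ → refl) α) ⟩
    k * ((λ β → -1^ length A * coeff (prod A) β) ⊛ b) α
      ≡⟨ cong (k *_) (⊛-scaleˡ (-1^ length A) (coeff (prod A)) b α) ⟩
    k * (-1^ length A * (coeff (prod A) ⊛ b) α)
      ≡⟨ *-exchange k (-1^ length A) ((coeff (prod A) ⊛ b) α) ⟩
    -1^ length A * (k * (coeff (prod A) ⊛ b) α)
      ≡⟨ cong (-1^ length A *_) (factors α) ⟩
    -1^ length A * coeff (prod G) α ∎
    where b = coeff (prod B)

  -- The axiom and `∑-shuffles-order` are two sums with the same value. By the induction hypothesis
  -- they agree in all terms but the leading one, hence also there.
  antipode-step : ∀ G → (∀ A → length A ℕ.< length G → S (prod A) ≈ -1^ length A • prod A) →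
                  S (prod G) ≈ -1^ length G • prod G
  antipode-step G ih α = cancel (begin
    coeff (S (prod G)) α ℚ.+ rest
      ≡⟨ cong₂ ℚ._+_ (sym (summand-top G α)) (sym (∑-cong T (All.zipWith
           (λ {t} (t<G , factors) → summand-factors G α t (ih (proj₁ (proj₂ t)) t<G) factors)
           (T< , All.tail (≡.subst (All (Factors G)) e (shuffles-factors G)))))) ⟩
    ∑ ((1ℚ , G , []) ∷ T) (summand α)
      ≡⟨ cong (λ T → ∑ T (summand α)) (sym e) ⟩
    ∑ (shuffles G) (summand α)
      ≡⟨ antipode-convolution G α ⟩
    ε (prod G) * one α
      ≡⟨ sym (∑-shuffles-order G α) ⟩
    ∑ (shuffles G) (λ t → -1^ order t * coeff (prod G) α)
      ≡⟨ cong (λ T → ∑ T (λ t → -1^ order t * coeff (prod G) α)) e ⟩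
    -1^ length G * coeff (prod G) α ℚ.+ rest ∎)
    where
    T  = proj₁ (shuffles-∷ G)
    e  = proj₁ (proj₂ (shuffles-∷ G))
    T< = proj₂ (proj₂ (shuffles-∷ G))

    rest : ℚ
    rest = ∑ T (λ t → -1^ order t * coeff (prod G) α)

    cancel : ∀ {x y z} → x ℚ.+ z ≡ y ℚ.+ z → x ≡ y
    cancel {x} {y} {z} x+z≡y+z = begin
      x                         ≡⟨ solve 2 (λ x z → x := (x :+ z) :+ con (- 1ℚ) :* z) refl x z ⟩
      x ℚ.+ z ℚ.+ - 1ℚ * z      ≡⟨ cong (ℚ._+ - 1ℚ * z) x+z≡y+z ⟩
      y ℚ.+ z ℚ.+ - 1ℚ * z      ≡⟨ solve 2 (λ x z → (x :+ z) :+ con (- 1ℚ) :* z := x) refl y z ⟩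
      y                         ∎

  antipode-prod : ∀ n G → length G ℕ.≤ n → S (prod G) ≈ -1^ length G • prod G
  antipode-prod zero    G G≤0 = antipode-step G λ A A<G → contradiction (ℕ.<-≤-trans A<G G≤0) λ ()
  antipode-prod (suc n) G G≤n = antipode-step G λ A A<G → antipode-prod n A (ℕ.≤-pred (ℕ.≤-trans A<G G≤n))

-- The grading automorphism

weight-↭ : ∀ (v : Power → ℕ) {α β} → α ↭ β → weight v α ≡ weight v β
weight-↭ v ↭.refl = refl
weight-↭ v (↭.prep a π) = cong (v a +_) (weight-↭ v π)
weight-↭ v (swap {ys = β} a b π) = trans
  (cong (λ n → v a + (v b + n)) (weight-↭ v π)) (exchange (v a) (v b) (weight v β))
  where
  exchange : ∀ a b n → a + (b + n) ≡ b + (a + n)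
  exchange = solve-∀
weight-↭ v (↭.trans π ρ) = trans (weight-↭ v π) (weight-↭ v ρ)

degree-stable : ∀ α → degree (α ++ [ x^0 ]) ≡ degree α
degree-stable []      = refl
degree-stable (a ∷ α) = cong (size a +_) (degree-stable α)

degree-additive : Additive degree
degree-additive α = All.map (λ {(β , γ)} (p , q) → begin
  degree β + degree γ                       ≡⟨ cong₂ _+_ (sym (degree-≡ β)) (sym (degree-≡ γ)) ⟩
  (xdeg β + θdeg β) + (xdeg γ + θdeg γ)     ≡⟨ interchange (xdeg β) (θdeg β) (xdeg γ) (θdeg γ) ⟩
  (xdeg β + xdeg γ) + (θdeg β + θdeg γ)     ≡⟨ cong₂ _+_ p q ⟩
  xdeg α + θdeg α                           ≡⟨ degree-≡ α ⟩
  degree α                                  ∎) (splits-degrees α)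
  where
  interchange : ∀ a b c d → (a + b) + (c + d) ≡ (a + c) + (b + d)
  interchange = solve-∀

grade : Λ → Λ
grade f = record
  { coeff     = signed degree (coeff f)
  ; stable    = λ α → cong₂ (λ n x → -1^ n * x) (degree-stable α) (Λ.stable f α)
  ; symmetric = λ {_} {β} π → trans
      (cong₂ (λ n x → -1^ n * x) (weight-↭ size π) (Λ.symmetric f π))
      (*-exchange (-1^ degree β) (sign π) (coeff f β))
  ; bounded   = proj₁ (Λ.bounded f) , λ α lt →
      trans (cong (-1^ degree α *_) (proj₂ (Λ.bounded f) α lt)) (*-zeroʳ (-1^ degree α))
  }

grade-homogeneous : ∀ {n m} f → Homogeneous n m f → grade f ≈ -1^ (m + n) • f
grade-homogeneous {n} {m} f f-hom α with coeff f α ℚ.≟ 0ℚ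
... | yes fα≡0 = trans (cong (-1^ degree α *_) fα≡0)
  (trans (*-zeroʳ (-1^ degree α)) (sym (trans (cong (-1^ (m + n) *_) fα≡0) (*-zeroʳ (-1^ (m + n))))))
... | no  fα≢0 = cong (λ k → -1^ k * coeff f α) (begin
  degree α          ≡⟨ sym (degree-≡ α) ⟩
  xdeg α + θdeg α   ≡⟨ cong₂ _+_ (proj₁ (f-hom α fα≢0)) (proj₂ (f-hom α fα≢0)) ⟩
  n + m             ≡⟨ ℕ.+-comm n m ⟩
  m + n             ∎)

-- Comparison with the homomorphism ω

linear-scale : ∀ {φ} → IsLinear φ → ∀ k {f g} → f ≈ k • g → φ f ≈ k • φ g
linear-scale φ-linear k {f} {g} f≈kg α = trans (⟦⟧-cong {f} {k • g} f≈kg α) (*ₗ-homo k g α)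
  where open IsLinear φ-linear using (⟦⟧-cong; *ₗ-homo)

module _ {ω : Λ → Λ} (ω-algebra : IsAlgebraHomomorphism ω)
  (ω-p : ∀ r .{{_ : NonZero r}} → ω (p r) ≈ -1^ (r ∸ 1) • p r)
  (ω-p~ : ∀ ℓ → ω (p~ ℓ) ≈ -1^ ℓ • p~ ℓ) where

  open IsAlgebraHomomorphism ω-algebra using () renaming (isRingHomomorphism to ω-ring; isLinear to ω-linear)
  open IsRingHomomorphism ω-ring using () renaming (*-homo to ω-⊠; 1#-homo to ω-𝟙)
  open IsLinear ω-linear using () renaming (⟦⟧-cong to ω-cong; *ₗ-homo to ω-•)

  private
    ω-p-sign : ∀ k x → -1^ suc k * (-1^ k * x) ≡ - 1ℚ * x
    ω-p-sign k x = begin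
      - 1ℚ * -1^ k * (-1^ k * x)
        ≡⟨ solve 2 (λ s x → con (- 1ℚ) :* s :* (s :* x) := (s :* s) :* (con (- 1ℚ) :* x)) refl (-1^ k) x ⟩
      -1^ k * -1^ k * (- 1ℚ * x)
        ≡⟨ cong (_* (- 1ℚ * x)) (trans (sym (-1^-+ k k)) (-1^-even k)) ⟩
      1ℚ * (- 1ℚ * x)
        ≡⟨ *-identityˡ (- 1ℚ * x) ⟩
      - 1ℚ * x ∎

  -- In both families the size of a generator exceeds by one the exponent of the sign that `ω` gives
  -- it, so the two signs multiply to -1, the value of `S` on a primitive element.
  ω-gen : ∀ g α → -1^ size (power g) * coeff (ω (gen g)) α ≡ - 1ℚ * powerSum (power g) α
  ω-gen (even r) α = trans
    (cong₂ (λ n x → -1^ n * x) (ℕ.+-identityʳ (suc r))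
      (trans (ω-cong {gen (even r)} {p (suc r)} (λ _ → refl) α) (ω-p (suc r) α)))
    (ω-p-sign r (powerSum (suc r , false) α))
  ω-gen (odd k)  α = trans
    (cong₂ (λ n x → -1^ n * x) (ℕ.+-comm k 1)
      (trans (ω-cong {gen (odd k)} {p~ k} (λ _ → refl) α) (ω-p~ k α)))
    (ω-p-sign k (powerSum (k , true) α))

  ω-grade-gen : ∀ g → ω (grade (gen g)) ≈ ⊟ gen g
  ω-grade-gen g α = trans
    (linear-scale ω-linear (-1^ size (power g)) {grade (gen g)} {gen g} (powerSum-weight size refl (power g)) α)
    (ω-gen g α)

  ω-product : ∀ {f g h} → f ≈ g ⊠ h → ω f ≈ ω g ⊠ ω h
  ω-product {f} {g} {h} f≈gh α = trans (ω-cong {f} {g ⊠ h} f≈gh α) (ω-⊠ g h α)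

  ω-grade-prod : ∀ G → ω (grade (prod G)) ≈ -1^ length G • prod G
  ω-grade-prod []      α = trans (ω-cong {grade (prod [])} {𝟙} (one-weight size refl) α)
    (trans (ω-𝟙 α) (sym (*-identityˡ (one α))))
  ω-grade-prod (g ∷ G) α = trans
    (ω-product {grade (prod (g ∷ G))} {grade (gen g)} {grade (prod G)}
      (signed-⊛ degree degree-additive (coeff (gen g)) (coeff (prod G))) α)
    (⊛-scale {f′ = coeff (gen g)} {g′ = coeff (prod G)} {k = - 1ℚ} {l = -1^ length G}
      (ω-grade-gen g) (ω-grade-prod G) α)

  antipode≈ω-grade : ∀ {S} → IsAntipode S → ∀ {f} → Span f → S f ≈ ω (grade f)
  antipode≈ω-grade {S} S-antipode = go
    where
    open IsLinear (IsAntipode.isLinear S-antipode) using () renaming (⟦⟧-cong to S-cong; +ᴹ-homo to S-⊞; *ₗ-homo to S-•)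
    open IsLinear ω-linear using () renaming (+ᴹ-homo to ω-⊞)

    go : ∀ {f} → Span f → S f ≈ ω (grade f)
    go (product G) α = trans (antipode-prod S-antipode (length G) G ℕ.≤-refl α) (sym (ω-grade-prod G α))
    go (sum {f} {g} s t) α = begin
      coeff (S (f ⊞ g)) α
        ≡⟨ S-⊞ f g α ⟩
      coeff (S f) α ℚ.+ coeff (S g) α
        ≡⟨ cong₂ ℚ._+_ (go s α) (go t α) ⟩
      coeff (ω (grade f)) α ℚ.+ coeff (ω (grade g)) α
        ≡⟨ sym (ω-⊞ (grade f) (grade g) α) ⟩
      coeff (ω (grade f ⊞ grade g)) α
        ≡⟨ ω-cong {grade f ⊞ grade g} {grade (f ⊞ g)}
             (λ β → sym (*-distribˡ-+ (-1^ degree β) (coeff f β) (coeff g β))) α ⟩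
      coeff (ω (grade (f ⊞ g))) α ∎
    go (scale k {f} s) α = begin
      coeff (S (k • f)) α
        ≡⟨ S-• k f α ⟩
      k * coeff (S f) α
        ≡⟨ cong (k *_) (go s α) ⟩
      k * coeff (ω (grade f)) α
        ≡⟨ sym (ω-• k (grade f) α) ⟩
      coeff (ω (k • grade f)) α
        ≡⟨ ω-cong {k • grade f} {grade (k • f)} (λ β → *-exchange k (-1^ degree β) (coeff f β)) α ⟩
      coeff (ω (grade (k • f))) α ∎
    go (resp {f} {g} f≈g s) α = begin
      coeff (S g) α           ≡⟨ S-cong {g} {f} (sym ∘ f≈g) α ⟩
      coeff (S f) α           ≡⟨ go s α ⟩
      coeff (ω (grade f)) α   ≡⟨ ω-cong {grade f} {grade g} (λ β → cong (-1^ degree β *_) (f≈g β)) α ⟩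
      coeff (ω (grade g)) α   ∎

proposition4p4 : (S ω : Λ → Λ) → IsAntipode S → IsAlgebraHomomorphism ω →
    (∀ r .{{_ : NonZero r}} → ω (p r) ≈ -1^ (r ∸ 1) • p r) →
    (∀ ℓ → ω (p~ ℓ) ≈ -1^ ℓ • p~ ℓ) →
    ∀ (f : Λ) (n m : ℕ) → Homogeneous n m f →
    S f ≈ -1^ (m + n) • ω f
proposition4p4 S ω S-antipode ω-algebra ω-p ω-p~ f n m f-hom α = trans
  (antipode≈ω-grade ω-algebra ω-p ω-p~ S-antipode (spanned f) α)
  (linear-scale (IsAlgebraHomomorphism.isLinear ω-algebra) (-1^ (m + n)) {grade f} {f} (grade-homogeneous f f-hom) α)
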